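{- Let $n$ and $m$ be positive integers and let $\xi_n \in \mathbb{C}$ be a primitive $n$-th root of unity. Let $a_1,\dots,a_m,b_1,\dots,b_m\in\mathbb{C}$ with no $nb_i$ a negative integer or zero, and let $z\in\mathbb{C}$ be such that all series on the left-hand side below converge. Then $$\sum_{l=0}^{n-1} {}_mF_{m}\left[ \begin{array}{cccc} n a_1, & n a_2, & \dots, & n a_m \\ n b_1, & n b_2, & \dots, & n b_m \end{array} \Big| \; \xi_n^l z \right] = n \cdot {}_{nm}F_{nm}\left[ \begin{array}{c} a_i+\frac{l}{n} : 1 \leq i \leq m,\ 0 \leq l \leq n-1 \\ b_i +\frac{l}{n} : 1 \leq i \leq m,\ 0 \leq l \leq n-1 \end{array} \Big| \; z^n \right].$$
   Context: The classical generalized hypergeometric series is, with the convention used here, $${}_mF_{m}\left[ \begin{array}{cccc} a_1, & a_2, & \dots, & a_m \\ b_1, & b_2, & \dots, & b_m \end{array} \Big| \; z \right] :=\sum_{k=0}^{\infty} \frac{(a_1)_k (a_2)_k \cdots (a_m)_k}{(b_1)_k (b_2)_k \cdots (b_m)_k}\, z^k,$$ where $a_i,b_i,z\in\mathbb{C}$, no $b_i$ is a negative integer or zero, $(a)_0:=1$ and $(a)_k:=a(a+1)\cdots(a+k-1)$ for $k\ge1$. (There is no additional $k!$ in the denominator; taking $b_1=1$ recovers the usual ${}_mF_{m-1}$.) -}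

module Defs where

open import Algebra.Bundles.Raw using (RawRing)
open import Data.Fin.Base using (Fin; toℕ; zero; suc; remQuot)
open import Data.Integer.Base as ℤ using (+_)
import Data.Integer.Properties as ℤ
open import Data.Nat.Base as ℕ using (ℕ; NonZero)
import Data.Nat.Properties as ℕ
open import Data.Product.Base using (Σ-syntax; ∃-syntax; _×_; _,_; proj₁)
open import Data.Rational.Base as ℚ using (ℚ; 0ℚ; 1ℚ; ½)
import Data.Rational.Properties as ℚ
open import Data.Rational.Solver using (module +-*-Solver)
import Data.Rational.Unnormalised.Base as ℚᵘ
import Data.Rational.Unnormalised.Properties as ℚᵘ
open import Data.Vec.Functional using (Vector)
open import Level using (0ℓ)
open import Relation.Binary.PropositionalEquality
open import Relation.Nullary using (¬_; yes; no; contradiction)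

-- Real numbers are Cauchy sequences of rationals (with a modulus), up to _≈ᴿ_.

Cauchy : (ℕ → ℚ) → Set
Cauchy x = ∀ ε → 0ℚ ℚ.< ε →
  ∃[ N ] ∀ i j → N ℕ.≤ i → N ℕ.≤ j → ℚ.∣ x i ℚ.- x j ∣ ℚ.< ε

record ℝ : Set where
  constructor mkℝ
  field
    seq    : ℕ → ℚ
    cauchy : Cauchy seq
open ℝ public

infix 4 _≈ᴿ_ _<ᴿ_

record _≈ᴿ_ (x y : ℝ) : Set where
  constructor mk≈
  field
    close : ∀ ε → 0ℚ ℚ.< ε →
      ∃[ N ] ∀ i → N ℕ.≤ i → ℚ.∣ seq x i ℚ.- seq y i ∣ ℚ.< ε

record _<ᴿ_ (x y : ℝ) : Set where
  constructor mk<
  field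
    gap       : ℚ
    0<gap     : 0ℚ ℚ.< gap
    from      : ℕ
    separated : ∀ i → from ℕ.≤ i → seq x i ℚ.+ gap ℚ.≤ seq y i

open +-*-Solver using (solve; _:=_; _:+_; _:*_; _:-_; :-_; con)

half-pos : ∀ {ε} → 0ℚ ℚ.< ε → 0ℚ ℚ.< ε ℚ.* ½
half-pos {ε} p =
  ℚ.positive⁻¹ _ {{ℚ.pos*pos⇒pos ε {{ℚ.positive p}} ½}}

*-pos : ∀ {p q} → 0ℚ ℚ.< p → 0ℚ ℚ.< q → 0ℚ ℚ.< p ℚ.* q
*-pos {p} {q} hp hq =
  ℚ.positive⁻¹ _ {{ℚ.pos*pos⇒pos p {{ℚ.positive hp}} q {{ℚ.positive hq}}}}

neg-involutive : ∀ q → ℚ.- ℚ.- q ≡ q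
neg-involutive = solve 1 (λ q → :- :- q := q) refl

halves : ∀ ε → ε ℚ.* ½ ℚ.+ ε ℚ.* ½ ≡ ε
halves = solve 1 (λ e → e :* con ½ :+ e :* con ½ := e) refl

-- the reciprocal of 0ℚ is a junk value, never reached in the tail that
-- determines the inverse of a positive real
recip : ℚ → ℚ
recip q with q ℚ.≟ 0ℚ
... | yes _  = 0ℚ
... | no q≢0 = ℚ.1/_ q {{ℚ.≢-nonZero q≢0}}

recip-inverse : ∀ {q} → 0ℚ ℚ.< q → q ℚ.* recip q ≡ 1ℚ
recip-inverse {q} 0<q with q ℚ.≟ 0ℚ
... | yes q≡0 = contradiction (sym q≡0) (ℚ.<⇒≢ 0<q)
... | no q≢0  = ℚ.*-inverseʳ q {{ℚ.≢-nonZero q≢0}}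

recip-pos : ∀ {q} → 0ℚ ℚ.< q → 0ℚ ℚ.< recip q
recip-pos {q} 0<q with q ℚ.≟ 0ℚ
... | yes q≡0 = contradiction (sym q≡0) (ℚ.<⇒≢ 0<q)
... | no q≢0  = ℚ.positive⁻¹ _ {{ℚ.1/pos⇒pos q {{ℚ.positive 0<q}}}}

const-cauchy : ∀ q → Cauchy (λ _ → q)
const-cauchy q ε 0<ε = 0 , λ _ _ _ _ →
  subst (ℚ._< ε) (sym (cong ℚ.∣_∣ (ℚ.+-inverseʳ q))) 0<ε

+-cauchy : ∀ {x y} → Cauchy x → Cauchy y → Cauchy (λ i → x i ℚ.+ y i)
+-cauchy {x} {y} cx cy ε 0<ε with cx _ (half-pos 0<ε) | cy _ (half-pos 0<ε)
... | M , hx | N , hy = M ℕ.⊔ N , λ i j hi hj →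
  let open ℚ.≤-Reasoning
      p = hx i j (ℕ.≤-trans (ℕ.m≤m⊔n M N) hi) (ℕ.≤-trans (ℕ.m≤m⊔n M N) hj)
      q = hy i j (ℕ.≤-trans (ℕ.m≤n⊔m M N) hi) (ℕ.≤-trans (ℕ.m≤n⊔m M N) hj)
  in begin-strict
    ℚ.∣ (x i ℚ.+ y i) ℚ.- (x j ℚ.+ y j) ∣
      ≡⟨ cong ℚ.∣_∣ (solve 4 (λ a b c d →
           (a :+ b) :- (c :+ d) := (a :- c) :+ (b :- d)) refl (x i) (y i) (x j) (y j)) ⟩
    ℚ.∣ (x i ℚ.- x j) ℚ.+ (y i ℚ.- y j) ∣
      ≤⟨ ℚ.∣p+q∣≤∣p∣+∣q∣ (x i ℚ.- x j) (y i ℚ.- y j) ⟩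
    ℚ.∣ x i ℚ.- x j ∣ ℚ.+ ℚ.∣ y i ℚ.- y j ∣
      <⟨ ℚ.+-mono-< p q ⟩
    ε ℚ.* ½ ℚ.+ ε ℚ.* ½
      ≡⟨ halves ε ⟩
    ε ∎

neg-cauchy : ∀ {x} → Cauchy x → Cauchy (λ i → ℚ.- x i)
neg-cauchy {x} cx ε 0<ε with cx ε 0<ε
... | N , h = N , λ i j hi hj → subst (ℚ._< ε)
  (trans (sym (ℚ.∣-p∣≡∣p∣ (x i ℚ.- x j)))
    (cong ℚ.∣_∣ (solve 2 (λ a b → :- (a :- b) := :- a :- :- b) refl (x i) (x j))))
  (h i j hi hj)

bounded : ∀ {x} → Cauchy x →
  ∃[ B ] 0ℚ ℚ.< B × (∃[ N ] ∀ i → N ℕ.≤ i → ℚ.∣ x i ∣ ℚ.≤ B)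
bounded {x} cx with cx 1ℚ (ℚ.positive⁻¹ 1ℚ)
... | N , h = 1ℚ ℚ.+ ℚ.∣ x N ∣
  , ℚ.+-mono-<-≤ (ℚ.positive⁻¹ 1ℚ) (ℚ.0≤∣p∣ (x N))
  , N , λ i hi →
  let open ℚ.≤-Reasoning in begin
    ℚ.∣ x i ∣
      ≡⟨ cong ℚ.∣_∣ (solve 2 (λ a b → a := (a :- b) :+ b) refl (x i) (x N)) ⟩
    ℚ.∣ (x i ℚ.- x N) ℚ.+ x N ∣
      ≤⟨ ℚ.∣p+q∣≤∣p∣+∣q∣ (x i ℚ.- x N) (x N) ⟩
    ℚ.∣ x i ℚ.- x N ∣ ℚ.+ ℚ.∣ x N ∣
      ≤⟨ ℚ.+-monoˡ-≤ ℚ.∣ x N ∣ (ℚ.<⇒≤ (h i N hi ℕ.≤-refl)) ⟩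
    1ℚ ℚ.+ ℚ.∣ x N ∣ ∎

∣*∣-≤ : ∀ p q {B} → ℚ.∣ p ∣ ℚ.≤ B → ℚ.∣ p ℚ.* q ∣ ℚ.≤ B ℚ.* ℚ.∣ q ∣
∣*∣-≤ p q h = ℚ.≤-trans (ℚ.≤-reflexive (ℚ.∣p*q∣≡∣p∣*∣q∣ p q))
  (ℚ.*-monoʳ-≤-nonNeg ℚ.∣ q ∣ {{ℚ.∣-∣-nonNeg q}} h)

cancel : ∀ {C} → 0ℚ ℚ.< C → ∀ q → C ℚ.* (recip C ℚ.* q) ≡ q
cancel {C} 0<C q = trans (sym (ℚ.*-assoc C (recip C) q))
  (trans (cong (ℚ._* q) (recip-inverse 0<C)) (ℚ.*-identityˡ q))

*-diff : ∀ a b c d → a ℚ.* b ℚ.- c ℚ.* d ≡ a ℚ.* (b ℚ.- d) ℚ.+ d ℚ.* (a ℚ.- c)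
*-diff = solve 4 (λ a b c d →
  a :* b :- c :* d := a :* (b :- d) :+ d :* (a :- c)) refl

*-close : ∀ {A B ε} a b c d → 0ℚ ℚ.< A → 0ℚ ℚ.< B →
  ℚ.∣ a ∣ ℚ.≤ A → ℚ.∣ d ∣ ℚ.≤ B →
  ℚ.∣ b ℚ.- d ∣ ℚ.< recip A ℚ.* (ε ℚ.* ½) →
  ℚ.∣ a ℚ.- c ∣ ℚ.< recip B ℚ.* (ε ℚ.* ½) →
  ℚ.∣ a ℚ.* b ℚ.- c ℚ.* d ∣ ℚ.< ε
*-close {A} {B} {ε} a b c d 0<A 0<B ∣a∣≤A ∣d∣≤B hb ha = begin-strict
  ℚ.∣ a ℚ.* b ℚ.- c ℚ.* d ∣
    ≡⟨ cong ℚ.∣_∣ (*-diff a b c d) ⟩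
  ℚ.∣ a ℚ.* (b ℚ.- d) ℚ.+ d ℚ.* (a ℚ.- c) ∣
    ≤⟨ ℚ.∣p+q∣≤∣p∣+∣q∣ (a ℚ.* (b ℚ.- d)) (d ℚ.* (a ℚ.- c)) ⟩
  ℚ.∣ a ℚ.* (b ℚ.- d) ∣ ℚ.+ ℚ.∣ d ℚ.* (a ℚ.- c) ∣
    ≤⟨ ℚ.+-mono-≤ (∣*∣-≤ a (b ℚ.- d) ∣a∣≤A) (∣*∣-≤ d (a ℚ.- c) ∣d∣≤B) ⟩
  A ℚ.* ℚ.∣ b ℚ.- d ∣ ℚ.+ B ℚ.* ℚ.∣ a ℚ.- c ∣
    <⟨ ℚ.+-mono-< (ℚ.*-monoʳ-<-pos A {{ℚ.positive 0<A}} hb)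
                  (ℚ.*-monoʳ-<-pos B {{ℚ.positive 0<B}} ha) ⟩
  A ℚ.* (recip A ℚ.* (ε ℚ.* ½)) ℚ.+ B ℚ.* (recip B ℚ.* (ε ℚ.* ½))
    ≡⟨ cong₂ ℚ._+_ (cancel 0<A (ε ℚ.* ½)) (cancel 0<B (ε ℚ.* ½)) ⟩
  ε ℚ.* ½ ℚ.+ ε ℚ.* ½
    ≡⟨ halves ε ⟩
  ε ∎
  where open ℚ.≤-Reasoning

*-cauchy : ∀ {x y} → Cauchy x → Cauchy y → Cauchy (λ i → x i ℚ.* y i)
*-cauchy {x} {y} cx cy ε 0<ε =
  let A , 0<A , K , bx = bounded cx
      B , 0<B , L , by = bounded cy
      M , hy = cy (recip A ℚ.* (ε ℚ.* ½)) (*-pos (recip-pos 0<A) (half-pos 0<ε))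
      N , hx = cx (recip B ℚ.* (ε ℚ.* ½)) (*-pos (recip-pos 0<B) (half-pos 0<ε))
      K≤ = ℕ.≤-trans (ℕ.m≤m⊔n K L) (ℕ.m≤m⊔n (K ℕ.⊔ L) (M ℕ.⊔ N))
      L≤ = ℕ.≤-trans (ℕ.m≤n⊔m K L) (ℕ.m≤m⊔n (K ℕ.⊔ L) (M ℕ.⊔ N))
      M≤ = ℕ.≤-trans (ℕ.m≤m⊔n M N) (ℕ.m≤n⊔m (K ℕ.⊔ L) (M ℕ.⊔ N))
      N≤ = ℕ.≤-trans (ℕ.m≤n⊔m M N) (ℕ.m≤n⊔m (K ℕ.⊔ L) (M ℕ.⊔ N))
  in (K ℕ.⊔ L) ℕ.⊔ (M ℕ.⊔ N) , λ i j hi hj →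
    *-close (x i) (y i) (x j) (y j) 0<A 0<B
      (bx i (ℕ.≤-trans K≤ hi)) (by j (ℕ.≤-trans L≤ hj))
      (hy i j (ℕ.≤-trans M≤ hi) (ℕ.≤-trans M≤ hj))
      (hx i j (ℕ.≤-trans N≤ hi) (ℕ.≤-trans N≤ hj))

recip-antitone : ∀ {p q} → 0ℚ ℚ.< p → p ℚ.≤ q → recip q ℚ.≤ recip p
recip-antitone {p} {q} 0<p p≤q = begin
  recip q                          ≡⟨ sym (ℚ.*-identityʳ (recip q)) ⟩
  recip q ℚ.* 1ℚ                   ≡⟨ cong (recip q ℚ.*_) (sym (recip-inverse 0<p)) ⟩
  recip q ℚ.* (p ℚ.* recip p)      ≤⟨ ℚ.*-monoˡ-≤-nonNeg (recip q) (ℚ.*-monoʳ-≤-nonNeg (recip p) p≤q) ⟩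
  recip q ℚ.* (q ℚ.* recip p)      ≡⟨ solve 3 (λ a b c → a :* (b :* c) := (b :* a) :* c) refl (recip q) q (recip p) ⟩
  (q ℚ.* recip q) ℚ.* recip p      ≡⟨ cong (ℚ._* recip p) (recip-inverse 0<q) ⟩
  1ℚ ℚ.* recip p                   ≡⟨ ℚ.*-identityˡ (recip p) ⟩
  recip p ∎
  where
  open ℚ.≤-Reasoning
  0<q = ℚ.<-≤-trans 0<p p≤q
  instance
    rq = ℚ.nonNegative (ℚ.<⇒≤ (recip-pos 0<q))
    rp = ℚ.nonNegative (ℚ.<⇒≤ (recip-pos 0<p))

recip-diff : ∀ {p q} → 0ℚ ℚ.< p → 0ℚ ℚ.< q →
  recip p ℚ.- recip q ≡ recip p ℚ.* (recip q ℚ.* ℚ.- (p ℚ.- q))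
recip-diff {p} {q} 0<p 0<q = trans
  (cong₂ ℚ._-_
    (trans (sym (ℚ.*-identityʳ u)) (cong (u ℚ.*_) (sym (recip-inverse 0<q))))
    (trans (sym (ℚ.*-identityʳ v)) (cong (v ℚ.*_) (sym (recip-inverse 0<p)))))
  (solve 4 (λ a b u v →
    u :* (b :* v) :- v :* (a :* u) := u :* (v :* :- (a :- b))) refl p q u v)
  where
  u = recip p
  v = recip q

δr : ∀ r δ ε → r ℚ.* (r ℚ.* (δ ℚ.* (δ ℚ.* ε))) ≡ (δ ℚ.* r) ℚ.* ((δ ℚ.* r) ℚ.* ε)
δr = solve 3 (λ a b e → a :* (a :* (b :* (b :* e))) := (b :* a) :* ((b :* a) :* e)) refl

recip-close : ∀ {δ ε p q} → 0ℚ ℚ.< δ → δ ℚ.≤ p → δ ℚ.≤ q →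
  ℚ.∣ p ℚ.- q ∣ ℚ.< δ ℚ.* (δ ℚ.* ε) → ℚ.∣ recip p ℚ.- recip q ∣ ℚ.< ε
recip-close {δ} {ε} {p} {q} 0<δ δ≤p δ≤q h = begin-strict
  ℚ.∣ recip p ℚ.- recip q ∣
    ≡⟨ cong ℚ.∣_∣ (recip-diff (ℚ.<-≤-trans 0<δ δ≤p) (ℚ.<-≤-trans 0<δ δ≤q)) ⟩
  ℚ.∣ recip p ℚ.* (recip q ℚ.* ℚ.- d) ∣
    ≤⟨ ∣*∣-≤ (recip p) (recip q ℚ.* ℚ.- d) (abs-≤ δ≤p) ⟩
  r ℚ.* ℚ.∣ recip q ℚ.* ℚ.- d ∣
    ≤⟨ ℚ.*-monoˡ-≤-nonNeg r {{ℚ.nonNegative (ℚ.<⇒≤ 0<r)}}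
         (∣*∣-≤ (recip q) (ℚ.- d) (abs-≤ δ≤q)) ⟩
  r ℚ.* (r ℚ.* ℚ.∣ ℚ.- d ∣)
    ≡⟨ cong (λ t → r ℚ.* (r ℚ.* t)) (ℚ.∣-p∣≡∣p∣ d) ⟩
  r ℚ.* (r ℚ.* ℚ.∣ d ∣)
    <⟨ ℚ.*-monoʳ-<-pos r {{ℚ.positive 0<r}} (ℚ.*-monoʳ-<-pos r {{ℚ.positive 0<r}} h) ⟩
  r ℚ.* (r ℚ.* (δ ℚ.* (δ ℚ.* ε)))
    ≡⟨ δr r δ ε ⟩
  (δ ℚ.* r) ℚ.* ((δ ℚ.* r) ℚ.* ε)
    ≡⟨ cong (λ t → t ℚ.* (t ℚ.* ε)) (recip-inverse 0<δ) ⟩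
  1ℚ ℚ.* (1ℚ ℚ.* ε)
    ≡⟨ trans (ℚ.*-identityˡ (1ℚ ℚ.* ε)) (ℚ.*-identityˡ ε) ⟩
  ε ∎
  where
  open ℚ.≤-Reasoning
  d = p ℚ.- q
  r = recip δ
  0<r = recip-pos 0<δ
  abs-≤ : ∀ {t} → δ ℚ.≤ t → ℚ.∣ recip t ∣ ℚ.≤ r
  abs-≤ δ≤t = ℚ.≤-trans
    (ℚ.≤-reflexive (ℚ.0≤p⇒∣p∣≡p (ℚ.<⇒≤ (recip-pos (ℚ.<-≤-trans 0<δ δ≤t)))))
    (recip-antitone 0<δ δ≤t)

recip-cauchy : ∀ {x} → Cauchy x → ∀ {δ} → 0ℚ ℚ.< δ →
  (∃[ N ] ∀ i → N ℕ.≤ i → δ ℚ.≤ x i) → Cauchy (λ i → recip (x i))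
recip-cauchy {x} cx {δ} 0<δ (M , h) ε 0<ε =
  let N , hx = cx (δ ℚ.* (δ ℚ.* ε)) (*-pos 0<δ (*-pos 0<δ 0<ε))
      M≤ = ℕ.m≤m⊔n M N
      N≤ = ℕ.m≤n⊔m M N
  in M ℕ.⊔ N , λ i j hi hj →
    recip-close 0<δ (h i (ℕ.≤-trans M≤ hi)) (h j (ℕ.≤-trans M≤ hj))
      (hx i j (ℕ.≤-trans N≤ hi) (ℕ.≤-trans N≤ hj))

infixl 6 _+ᴿ_ _-ᴿ_
infixl 7 _*ᴿ_
infix  8 -ᴿ_

fromℚᴿ : ℚ → ℝ
fromℚᴿ q = mkℝ (λ _ → q) (const-cauchy q)

0ᴿ : ℝ
0ᴿ = fromℚᴿ 0ℚ

-- The arithmetic is opaque so that the type checker does not unfold it into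
-- arithmetic on numerators and denominators; seq-+ etc. give its values.
opaque
  _+ᴿ_ : ℝ → ℝ → ℝ
  x +ᴿ y = mkℝ (λ i → seq x i ℚ.+ seq y i)
    (+-cauchy {seq x} {seq y} (cauchy x) (cauchy y))

  -ᴿ_ : ℝ → ℝ
  -ᴿ x = mkℝ (λ i → ℚ.- seq x i) (neg-cauchy {seq x} (cauchy x))

  _*ᴿ_ : ℝ → ℝ → ℝ
  x *ᴿ y = mkℝ (λ i → seq x i ℚ.* seq y i)
    (*-cauchy {seq x} {seq y} (cauchy x) (cauchy y))

  inverseᴿ : (x : ℝ) → 0ᴿ <ᴿ x → ℝ
  inverseᴿ x (mk< δ 0<δ N h) = mkℝ (λ i → recip (seq x i))
    (recip-cauchy {seq x} (cauchy x) 0<δ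
      (N , λ i hi → subst (ℚ._≤ seq x i) (ℚ.+-identityˡ δ) (h i hi)))

  seq-+ : ∀ x y i → seq (x +ᴿ y) i ≡ seq x i ℚ.+ seq y i
  seq-+ _ _ _ = refl

  seq-neg : ∀ x i → seq (-ᴿ x) i ≡ ℚ.- seq x i
  seq-neg _ _ = refl

  seq-* : ∀ x y i → seq (x *ᴿ y) i ≡ seq x i ℚ.* seq y i
  seq-* _ _ _ = refl

  seq-inverse : ∀ x 0<x i → seq (inverseᴿ x 0<x) i ≡ recip (seq x i)
  seq-inverse _ _ _ = refl

_-ᴿ_ : ℝ → ℝ → ℝ
x -ᴿ y = x +ᴿ (-ᴿ y)

seq-- : ∀ x y i → seq (x -ᴿ y) i ≡ seq x i ℚ.- seq y i
seq-- x y i = trans (seq-+ x (-ᴿ y) i) (cong (seq x i ℚ.+_) (seq-neg y i))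

record ℂ : Set where
  constructor mkℂ
  field
    re im : ℝ
open ℂ public

infix  4 _≈_ _#_
infixl 6 _+_ _-_
infixl 7 _*_
infix  8 -_

_≈_ : ℂ → ℂ → Set
z ≈ w = re z ≈ᴿ re w × im z ≈ᴿ im w

fromℚ : ℚ → ℂ
fromℚ q = mkℂ (fromℚᴿ q) 0ᴿ

fromℕ : ℕ → ℂ
fromℕ k = fromℚ (+ k ℚ./ 1)

_+_ : ℂ → ℂ → ℂ
z + w = mkℂ (re z +ᴿ re w) (im z +ᴿ im w)

-_ : ℂ → ℂ
- z = mkℂ (-ᴿ re z) (-ᴿ im z)

_-_ : ℂ → ℂ → ℂ
z - w = z + (- w)

_*_ : ℂ → ℂ → ℂ
z * w = mkℂ (re z *ᴿ re w -ᴿ im z *ᴿ im w) (re z *ᴿ im w +ᴿ im z *ᴿ re w)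

∣_∣² : ℂ → ℝ
∣ z ∣² = re z *ᴿ re z +ᴿ im z *ᴿ im z

-- "z ≠ w" in the positive sense needed for division: their distance is
-- positive.  Classically this is the same as ¬ (z ≈ w).
record _#_ (z w : ℂ) : Set where
  constructor apart
  field
    0<∣-∣² : 0ᴿ <ᴿ ∣ z - w ∣²
open _#_ public

ℂ-rawRing : RawRing 0ℓ 0ℓ
ℂ-rawRing = record
  { Carrier = ℂ ; _≈_ = _≈_
  ; _+_ = _+_ ; _*_ = _*_ ; -_ = -_ ; 0# = fromℕ 0 ; 1# = fromℕ 1 }

open import Algebra.Definitions.RawSemiring (RawRing.rawSemiring ℂ-rawRing) public
  using (_^_; sum; product)

normℚ : ℚ → ℚ → ℚ
normℚ a b = a ℚ.* a ℚ.+ b ℚ.* b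

seq-∣-∣² : ∀ z i → seq ∣ z ∣² i ≡ normℚ (seq (re z) i) (seq (im z) i)
seq-∣-∣² z i = trans (seq-+ (re z *ᴿ re z) (im z *ᴿ im z) i)
  (cong₂ ℚ._+_ (seq-* (re z) (re z) i) (seq-* (im z) (im z) i))

seq-∣sub∣² : ∀ z w i → seq ∣ z - w ∣² i ≡
  normℚ (seq (re z) i ℚ.- seq (re w) i) (seq (im z) i ℚ.- seq (im w) i)
seq-∣sub∣² z w i = trans (seq-∣-∣² (z - w) i)
  (cong₂ normℚ (seq-- (re z) (re w) i) (seq-- (im z) (im w) i))

<ᴿ-pointwise : ∀ {x y} → (∀ i → seq x i ≡ seq y i) → 0ᴿ <ᴿ x → 0ᴿ <ᴿ y
<ᴿ-pointwise eq (mk< δ 0<δ N h) =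
  mk< δ 0<δ N λ i hi → subst (0ℚ ℚ.+ δ ℚ.≤_) (eq i) (h i hi)

∣z-0∣² : ∀ z i → seq ∣ z - fromℕ 0 ∣² i ≡ seq ∣ z ∣² i
∣z-0∣² z i = trans (seq-∣sub∣² z (fromℕ 0) i)
  (trans (cong₂ normℚ (ℚ.+-identityʳ (seq (re z) i)) (ℚ.+-identityʳ (seq (im z) i)))
    (sym (seq-∣-∣² z i)))

#⇒∣-∣²-pos : ∀ {z} → z # fromℕ 0 → 0ᴿ <ᴿ ∣ z ∣²
#⇒∣-∣²-pos {z} (apart h) = <ᴿ-pointwise (∣z-0∣² z) h

∣-∣²-pos⇒# : ∀ {z} → 0ᴿ <ᴿ ∣ z ∣² → z # fromℕ 0
∣-∣²-pos⇒# {z} h = apart (<ᴿ-pointwise (λ i → sym (∣z-0∣² z i)) h)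

-- z⁻¹ = z̄ / ∣z∣²
inverse : (z : ℂ) → z # fromℕ 0 → ℂ
inverse z z#0 = mkℂ (re z *ᴿ r) ((-ᴿ im z) *ᴿ r)
  where r = inverseᴿ ∣ z ∣² (#⇒∣-∣²-pos {z} z#0)

*ᴿ-pos : ∀ {x y} → 0ᴿ <ᴿ x → 0ᴿ <ᴿ y → 0ᴿ <ᴿ x *ᴿ y
*ᴿ-pos {x} {y} (mk< δ 0<δ M hx) (mk< η 0<η N hy) =
  mk< (δ ℚ.* η) (*-pos 0<δ 0<η) (M ℕ.⊔ N) λ i hi → begin
    0ℚ ℚ.+ δ ℚ.* η         ≡⟨ ℚ.+-identityˡ (δ ℚ.* η) ⟩
    δ ℚ.* η                ≤⟨ ℚ.*-monoʳ-≤-nonNeg η {{ℚ.nonNegative (ℚ.<⇒≤ 0<η)}} (δ≤x i hi) ⟩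
    seq x i ℚ.* η          ≤⟨ ℚ.*-monoˡ-≤-nonNeg (seq x i)
                                {{ℚ.nonNegative (ℚ.<⇒≤ (ℚ.<-≤-trans 0<δ (δ≤x i hi)))}} (η≤y i hi) ⟩
    seq x i ℚ.* seq y i    ≡⟨ seq-* x y i ⟨
    seq (x *ᴿ y) i         ∎
  where
  open ℚ.≤-Reasoning
  δ≤x : ∀ i → M ℕ.⊔ N ℕ.≤ i → δ ℚ.≤ seq x i
  δ≤x i hi = subst (ℚ._≤ seq x i) (ℚ.+-identityˡ δ) (hx i (ℕ.≤-trans (ℕ.m≤m⊔n M N) hi))
  η≤y : ∀ i → M ℕ.⊔ N ℕ.≤ i → η ℚ.≤ seq y i
  η≤y i hi = subst (ℚ._≤ seq y i) (ℚ.+-identityˡ η) (hy i (ℕ.≤-trans (ℕ.m≤n⊔m M N) hi))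

seq-re-* : ∀ z w i → seq (re (z * w)) i ≡
  seq (re z) i ℚ.* seq (re w) i ℚ.- seq (im z) i ℚ.* seq (im w) i
seq-re-* z w i = trans (seq-- (re z *ᴿ re w) (im z *ᴿ im w) i)
  (cong₂ ℚ._-_ (seq-* (re z) (re w) i) (seq-* (im z) (im w) i))

seq-im-* : ∀ z w i → seq (im (z * w)) i ≡
  seq (re z) i ℚ.* seq (im w) i ℚ.+ seq (im z) i ℚ.* seq (re w) i
seq-im-* z w i = trans (seq-+ (re z *ᴿ im w) (im z *ᴿ re w) i)
  (cong₂ ℚ._+_ (seq-* (re z) (im w) i) (seq-* (im z) (re w) i))

normℚ-* : ∀ a b c d → normℚ a b ℚ.* normℚ c d ≡
  normℚ (a ℚ.* c ℚ.- b ℚ.* d) (a ℚ.* d ℚ.+ b ℚ.* c)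
normℚ-* = solve 4 (λ a b c d →
  (a :* a :+ b :* b) :* (c :* c :+ d :* d)
  := (a :* c :- b :* d) :* (a :* c :- b :* d) :+ (a :* d :+ b :* c) :* (a :* d :+ b :* c)) refl

∣*∣² : ∀ z w i → seq (∣ z ∣² *ᴿ ∣ w ∣²) i ≡ seq ∣ z * w ∣² i
∣*∣² z w i = begin
  seq (∣ z ∣² *ᴿ ∣ w ∣²) i                ≡⟨ seq-* ∣ z ∣² ∣ w ∣² i ⟩
  seq ∣ z ∣² i ℚ.* seq ∣ w ∣² i           ≡⟨ cong₂ ℚ._*_ (seq-∣-∣² z i) (seq-∣-∣² w i) ⟩
  normℚ a b ℚ.* normℚ c d                 ≡⟨ normℚ-* a b c d ⟩
  normℚ (a ℚ.* c ℚ.- b ℚ.* d) (a ℚ.* d ℚ.+ b ℚ.* c)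
    ≡⟨ cong₂ normℚ (seq-re-* z w i) (seq-im-* z w i) ⟨
  normℚ (seq (re (z * w)) i) (seq (im (z * w)) i)
    ≡⟨ seq-∣-∣² (z * w) i ⟨
  seq ∣ z * w ∣² i                        ∎
  where
  open ≡-Reasoning
  a = seq (re z) i
  b = seq (im z) i
  c = seq (re w) i
  d = seq (im w) i

*-#0 : ∀ {z w} → z # fromℕ 0 → w # fromℕ 0 → z * w # fromℕ 0
*-#0 {z} {w} z#0 w#0 =
  ∣-∣²-pos⇒# (<ᴿ-pointwise (∣*∣² z w) (*ᴿ-pos (#⇒∣-∣²-pos z#0) (#⇒∣-∣²-pos w#0)))

1#0 : fromℕ 1 # fromℕ 0
1#0 = ∣-∣²-pos⇒# (mk< 1ℚ (ℚ.positive⁻¹ 1ℚ) 0 λ i _ →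
  ℚ.≤-reflexive (sym (seq-∣-∣² (fromℕ 1) i)))

product-#0 : ∀ {k} (f : Vector ℂ k) → (∀ j → f j # fromℕ 0) → product f # fromℕ 0
product-#0 {ℕ.zero}  f h = 1#0
product-#0 {ℕ.suc k} f h =
  *-#0 {f zero} {product (λ j → f (suc j))}
    (h zero) (product-#0 (λ j → f (suc j)) (λ j → h (suc j)))

record IsPrimitiveRoot (n : ℕ) (ξ : ℂ) : Set where
  field
    ξⁿ≈1      : ξ ^ n ≈ fromℕ 1
    ξᵏ≉1      : ∀ k → 0 ℕ.< k → k ℕ.< n → ¬ (ξ ^ k ≈ fromℕ 1)

partialSum : (ℕ → ℂ) → ℕ → ℂ
partialSum t p = sum {p} (λ k → t (toℕ k))

-- ∣ z ∣ < ε is expressed as ∣ z ∣² < ε².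
_SumsTo_ : (ℕ → ℂ) → ℂ → Set
t SumsTo s = ∀ ε → 0ℚ ℚ.< ε →
  ∃[ N ] ∀ p → N ℕ.≤ p → ∣ partialSum t p - s ∣² <ᴿ fromℚᴿ (ε ℚ.* ε)

Convergent : (ℕ → ℂ) → Set
Convergent t = Σ[ s ∈ ℂ ] t SumsTo s

∑∞ : (t : ℕ → ℂ) → Convergent t → ℂ
∑∞ t = proj₁

-- a (a + 1) ⋯ (a + k - 1)
pochhammer : ℂ → ℕ → ℂ
pochhammer a k = product {k} (λ j → a + fromℕ (toℕ j))

NoNonPositiveInteger : ℂ → Set
NoNonPositiveInteger b = ∀ p → b # - fromℕ p

∣b+p∣² : ∀ b p i → seq ∣ b - - fromℕ p ∣² i ≡ seq ∣ b + fromℕ p ∣² i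
∣b+p∣² b p i = begin
  seq ∣ b - - fromℕ p ∣² i
    ≡⟨ seq-∣sub∣² b (- fromℕ p) i ⟩
  normℚ (x ℚ.- seq (-ᴿ fromℚᴿ P) i) (y ℚ.- seq (-ᴿ 0ᴿ) i)
    ≡⟨ cong₂ normℚ (neg-neg x (fromℚᴿ P)) (neg-neg y 0ᴿ) ⟩
  normℚ (x ℚ.+ P) (y ℚ.+ 0ℚ)
    ≡⟨ cong₂ normℚ (seq-+ (re b) (fromℚᴿ P) i) (seq-+ (im b) 0ᴿ i) ⟨
  normℚ (seq (re (b + fromℕ p)) i) (seq (im (b + fromℕ p)) i)
    ≡⟨ seq-∣-∣² (b + fromℕ p) i ⟨
  seq ∣ b + fromℕ p ∣² i ∎
  where
  open ≡-Reasoning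
  x = seq (re b) i
  y = seq (im b) i
  P = + p ℚ./ 1
  neg-neg : ∀ a r → a ℚ.- seq (-ᴿ r) i ≡ a ℚ.+ seq r i
  neg-neg a r = cong (a ℚ.+_) (trans (cong ℚ.-_ (seq-neg r i)) (neg-involutive (seq r i)))

NoNonPositiveInteger⇒+-#0 : ∀ {b} → NoNonPositiveInteger b → ∀ p → b + fromℕ p # fromℕ 0
NoNonPositiveInteger⇒+-#0 {b} h p =
  ∣-∣²-pos⇒# (<ᴿ-pointwise (∣b+p∣² b p) (0<∣-∣² (h p)))

pochhammer-#0 : ∀ b → NoNonPositiveInteger b → ∀ k → pochhammer b k # fromℕ 0
pochhammer-#0 b h k = product-#0 {k} (λ j → b + fromℕ (toℕ j))
  (λ j → NoNonPositiveInteger⇒+-#0 h (toℕ j))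

-- There is no factor 1 / k!: the denominator is (b₁)ₖ ⋯ (bₘ)ₖ only.
F-term : ∀ {m} (a b : Vector ℂ m) → (∀ i → NoNonPositiveInteger (b i)) → ℂ → ℕ → ℂ
F-term a b hb z k =
  product (λ i → pochhammer (a i) k)
  * inverse (product (λ i → pochhammer (b i) k))
            (product-#0 _ (λ i → pochhammer-#0 (b i) (hb i) k))
  * z ^ k

-- Position l m + i holds c i + l / n.
shifts : ∀ n .{{_ : NonZero n}} {m} → Vector ℂ m → Vector ℂ (n ℕ.* m)
shifts n {m} c j =
  let l , i = remQuot {n} m j in c i + fromℚ (+ toℕ l ℚ./ n)

shift-arith : ∀ n .{{_ : NonZero n}} l p →
  + (l ℕ.+ n ℕ.* p) ℚ./ 1 ≡ (+ n ℚ./ 1) ℚ.* ((+ l ℚ./ n) ℚ.+ (+ p ℚ./ 1))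
shift-arith n@(ℕ.suc _) l p = ℚ.toℚᵘ-injective (begin
  ℚ.toℚᵘ (+ (l ℕ.+ n ℕ.* p) ℚ./ 1)
    ≈⟨ ℚ.toℚᵘ-fromℚᵘ (+ (l ℕ.+ n ℕ.* p) ℚᵘ./ 1) ⟩
  + (l ℕ.+ n ℕ.* p) ℚᵘ./ 1
    ≈⟨ ℚᵘ.*≡* integers ⟩
  (+ n ℚᵘ./ 1) ℚᵘ.* ((+ l ℚᵘ./ n) ℚᵘ.+ (+ p ℚᵘ./ 1))
    ≈⟨ ℚᵘ.*-cong (ℚ.toℚᵘ-fromℚᵘ (+ n ℚᵘ./ 1))
         (ℚᵘ.+-cong (ℚ.toℚᵘ-fromℚᵘ (+ l ℚᵘ./ n)) (ℚ.toℚᵘ-fromℚᵘ (+ p ℚᵘ./ 1))) ⟨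
  ℚ.toℚᵘ (+ n ℚ./ 1) ℚᵘ.* (ℚ.toℚᵘ (+ l ℚ./ n) ℚᵘ.+ ℚ.toℚᵘ (+ p ℚ./ 1))
    ≈⟨ ℚᵘ.*-congˡ {ℚ.toℚᵘ (+ n ℚ./ 1)} (ℚ.toℚᵘ-homo-+ (+ l ℚ./ n) (+ p ℚ./ 1)) ⟨
  ℚ.toℚᵘ (+ n ℚ./ 1) ℚᵘ.* ℚ.toℚᵘ ((+ l ℚ./ n) ℚ.+ (+ p ℚ./ 1))
    ≈⟨ ℚ.toℚᵘ-homo-* (+ n ℚ./ 1) ((+ l ℚ./ n) ℚ.+ (+ p ℚ./ 1)) ⟨
  ℚ.toℚᵘ ((+ n ℚ./ 1) ℚ.* ((+ l ℚ./ n) ℚ.+ (+ p ℚ./ 1))) ∎)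
  where
  open ℚᵘ.≃-Reasoning
  open import Data.Integer.Solver using () renaming (module +-*-Solver to ℤ-Solver)
  open ℤ-Solver using () renaming
    (solve to solveᶻ; _:=_ to _:=ᶻ_; _:+_ to _:+ᶻ_; _:*_ to _:*ᶻ_; con to conᶻ)
  integers : + (l ℕ.+ n ℕ.* p) ℤ.* + (1 ℕ.* (n ℕ.* 1))
           ≡ (+ n ℤ.* (+ l ℤ.* + 1 ℤ.+ + p ℤ.* + n)) ℤ.* + 1
  integers = trans
    (cong₂ ℤ._*_
      (trans (ℤ.pos-+ l (n ℕ.* p)) (cong (λ t → + l ℤ.+ t) (ℤ.pos-* n p)))
      (cong +_ (trans (ℕ.*-identityˡ (n ℕ.* 1)) (ℕ.*-identityʳ n))))
    (solveᶻ 3 (λ N L P → (L :+ᶻ N :*ᶻ P) :*ᶻ N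
       :=ᶻ (N :*ᶻ (L :*ᶻ conᶻ (+ 1) :+ᶻ P :*ᶻ N)) :*ᶻ conᶻ (+ 1)) refl (+ n) (+ l) (+ p))

rescale-normℚ : ∀ r N L P x y → (r ℚ.* r) ℚ.*
    normℚ ((N ℚ.* x ℚ.- 0ℚ ℚ.* y) ℚ.+ N ℚ.* (L ℚ.+ P)) ((N ℚ.* y ℚ.+ 0ℚ ℚ.* x) ℚ.+ 0ℚ)
  ≡ ((N ℚ.* r) ℚ.* (N ℚ.* r)) ℚ.* normℚ ((x ℚ.+ L) ℚ.+ P) ((y ℚ.+ 0ℚ) ℚ.+ 0ℚ)
rescale-normℚ = solve 6 (λ r N L P x y → (r :* r) :*
    ( ((N :* x :- con 0ℚ :* y) :+ N :* (L :+ P)) :* ((N :* x :- con 0ℚ :* y) :+ N :* (L :+ P))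
    :+ ((N :* y :+ con 0ℚ :* x) :+ con 0ℚ) :* ((N :* y :+ con 0ℚ :* x) :+ con 0ℚ) )
  := ((N :* r) :* (N :* r)) :*
    ( ((x :+ L) :+ P) :* ((x :+ L) :+ P)
    :+ ((y :+ con 0ℚ) :+ con 0ℚ) :* ((y :+ con 0ℚ) :+ con 0ℚ) )) refl

-- n (b + l/n + p) = n b + (l + n p)
shift-NoNonPositiveInteger : ∀ n .{{_ : NonZero n}} b (l : ℕ) →
  NoNonPositiveInteger (fromℕ n * b) → NoNonPositiveInteger (b + fromℚ (+ l ℚ./ n))
shift-NoNonPositiveInteger n b l h p =
  apart (<ᴿ-pointwise rescale (*ᴿ-pos r²-pos (0<∣-∣² (h q))))
  where
  q = l ℕ.+ n ℕ.* p
  N = + n ℚ./ 1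
  L = + l ℚ./ n
  P = + p ℚ./ 1
  r = recip N
  0<N : 0ℚ ℚ.< N
  0<N = ℚ.positive⁻¹ N {{ℚ.normalize-pos n 1}}
  r²-pos : 0ᴿ <ᴿ fromℚᴿ (r ℚ.* r)
  r²-pos = mk< (r ℚ.* r) (*-pos (recip-pos 0<N) (recip-pos 0<N)) 0
    λ _ _ → ℚ.≤-reflexive (ℚ.+-identityˡ (r ℚ.* r))
  rescale : ∀ i → seq (fromℚᴿ (r ℚ.* r) *ᴿ ∣ fromℕ n * b - - fromℕ q ∣²) i
                ≡ seq ∣ (b + fromℚ L) - - fromℕ p ∣² i
  rescale i = begin
    seq (fromℚᴿ (r ℚ.* r) *ᴿ ∣ fromℕ n * b - - fromℕ q ∣²) i
      ≡⟨ seq-* (fromℚᴿ (r ℚ.* r)) ∣ fromℕ n * b - - fromℕ q ∣² i ⟩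
    (r ℚ.* r) ℚ.* seq ∣ fromℕ n * b - - fromℕ q ∣² i
      ≡⟨ cong (r ℚ.* r ℚ.*_) (∣b+p∣² (fromℕ n * b) q i) ⟩
    (r ℚ.* r) ℚ.* seq ∣ fromℕ n * b + fromℕ q ∣² i
      ≡⟨ cong (r ℚ.* r ℚ.*_) (trans (seq-∣-∣² (fromℕ n * b + fromℕ q) i)
           (cong₂ normℚ
             (trans (seq-+ (re (fromℕ n * b)) (fromℚᴿ (+ q ℚ./ 1)) i)
               (cong₂ ℚ._+_ (seq-re-* (fromℕ n) b i) (shift-arith n l p)))
             (trans (seq-+ (im (fromℕ n * b)) 0ᴿ i)
               (cong (ℚ._+ 0ℚ) (seq-im-* (fromℕ n) b i))))) ⟩
    (r ℚ.* r) ℚ.* normℚ ((N ℚ.* x ℚ.- 0ℚ ℚ.* y) ℚ.+ N ℚ.* (L ℚ.+ P))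
                        ((N ℚ.* y ℚ.+ 0ℚ ℚ.* x) ℚ.+ 0ℚ)
      ≡⟨ rescale-normℚ r N L P x y ⟩
    ((N ℚ.* r) ℚ.* (N ℚ.* r)) ℚ.* target
      ≡⟨ cong (λ t → (t ℚ.* t) ℚ.* target) (recip-inverse 0<N) ⟩
    (1ℚ ℚ.* 1ℚ) ℚ.* target
      ≡⟨ ℚ.*-identityˡ target ⟩
    target
      ≡⟨ cong₂ normℚ
           (trans (seq-+ (re (b + fromℚ L)) (fromℚᴿ P) i) (cong (ℚ._+ P) (seq-+ (re b) (fromℚᴿ L) i)))
           (trans (seq-+ (im (b + fromℚ L)) 0ᴿ i) (cong (ℚ._+ 0ℚ) (seq-+ (im b) 0ᴿ i))) ⟨
    normℚ (seq (re (b + fromℚ L + fromℕ p)) i) (seq (im (b + fromℚ L + fromℕ p)) i)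
      ≡⟨ seq-∣-∣² (b + fromℚ L + fromℕ p) i ⟨
    seq ∣ b + fromℚ L + fromℕ p ∣² i
      ≡⟨ ∣b+p∣² (b + fromℚ L) p i ⟨
    seq ∣ (b + fromℚ L) - - fromℕ p ∣² i ∎
    where
    open ≡-Reasoning
    x = seq (re b) i
    y = seq (im b) i
    target = normℚ ((x ℚ.+ L) ℚ.+ P) ((y ℚ.+ 0ℚ) ℚ.+ 0ℚ)

shifts-NoNonPositiveInteger : ∀ n .{{_ : NonZero n}} {m} (b : Vector ℂ m) →
  (∀ i → NoNonPositiveInteger (fromℕ n * b i)) →
  ∀ j → NoNonPositiveInteger (shifts n b j)
shifts-NoNonPositiveInteger n {m} b h j =
  let l , i = remQuot {n} m j in shift-NoNonPositiveInteger n (b i) (toℕ l) (h i)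

{-# OPTIONS --safe #-}

-- With c_k the coefficient of z^k in the series with parameters n aᵢ, n bᵢ, the
-- sum over l of c_k (ξ^l z)^k is c_k z^k times the l-sum of (ξ^k)^l, which is n
-- if n divides k and 0 otherwise.  Hence the left partial sums of length n p add
-- up to n times the p-th partial sum of c_{nk} z^{nk}, and
-- (n a)_{nk} = n^{nk} ∏_l (a + l/n)_k identifies c_{nk} with the coefficient on
-- the right.  Convergence of the right-hand side follows by dividing by n.

module Submission where

open import Defs
open import Algebra.Bundles using (CommutativeMonoid; CommutativeRing)
open import Data.Fin.Base as Fin using (Fin; toℕ; zero; suc; combine)
import Data.Fin.Properties as Fin
open import Data.Integer.Base using (+_)
open import Data.Nat.Base as ℕ using (ℕ; NonZero)
import Data.Nat.Properties as ℕ
open import Data.Product.Base using (Σ-syntax; ∃-syntax; _,_; proj₂)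
open import Data.Rational.Base as ℚ using (ℚ; 0ℚ; 1ℚ; ½)
import Data.Rational.Properties as ℚ
open import Data.Rational.Solver using (module +-*-Solver)
open import Data.Sum.Base using (inj₁; inj₂)
open import Data.Vec.Functional using (Vector)
open import Function.Base using (case_of_)
open import Level using (0ℓ)
open import Relation.Binary.Bundles using (Setoid)
open import Relation.Binary.Structures using (IsEquivalence)
open import Relation.Binary.PropositionalEquality as ≡ using (_≡_; cong; cong₂; subst)
open import Relation.Nullary using (¬_; yes; no; contradiction)

open +-*-Solver using (solve; _:=_; _:+_; _:*_; _:-_; :-_; con)

-- Properties of all but finitely many indices.

Eventually : (ℕ → Set) → Set
Eventually P = ∃[ N ] ∀ i → N ℕ.≤ i → P i

eventually-map : ∀ {P Q : ℕ → Set} → (∀ i → P i → Q i) → Eventually P → Eventually Q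
eventually-map f (N , p) = N , λ i N≤i → f i (p i N≤i)

eventually-zip : ∀ {P Q R : ℕ → Set} →
  (∀ i → P i → Q i → R i) → Eventually P → Eventually Q → Eventually R
eventually-zip f (M , p) (N , q) = M ℕ.⊔ N , λ i hi →
  f i (p i (ℕ.≤-trans (ℕ.m≤m⊔n M N) hi)) (q i (ℕ.≤-trans (ℕ.m≤n⊔m M N) hi))

-- Real numbers

-- A tail determines a real. For `*ᴿ-inverseʳ` agreement at every index would be too much to ask:
-- before the tail on which the sequence is positive, an entry may be 0 and its reciprocal the
-- default value.
≈ᴿ-eventually : ∀ {x y} → Eventually (λ i → seq x i ≡ seq y i) → x ≈ᴿ y
≈ᴿ-eventually {x} {y} h = mk≈ λ ε 0<ε → eventually-map
  (λ i eq → subst (ℚ._< ε)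
    (≡.sym (cong ℚ.∣_∣ (≡.trans (cong (ℚ._- seq y i) eq) (ℚ.+-inverseʳ (seq y i))))) 0<ε) h

≈ᴿ-pointwise : ∀ {x y} → (∀ i → seq x i ≡ seq y i) → x ≈ᴿ y
≈ᴿ-pointwise eq = ≈ᴿ-eventually (0 , λ i _ → eq i)

≈ᴿ-refl : ∀ {x} → x ≈ᴿ x
≈ᴿ-refl = ≈ᴿ-pointwise λ _ → ≡.refl

∣p-q∣≡∣q-p∣ : ∀ p q → ℚ.∣ p ℚ.- q ∣ ≡ ℚ.∣ q ℚ.- p ∣
∣p-q∣≡∣q-p∣ p q = ≡.trans (≡.sym (ℚ.∣-p∣≡∣p∣ (p ℚ.- q)))
  (cong ℚ.∣_∣ (solve 2 (λ p q → :- (p :- q) := q :- p) ≡.refl p q))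

∣p-r∣≤∣p-q∣+∣q-r∣ : ∀ p q r → ℚ.∣ p ℚ.- r ∣ ℚ.≤ ℚ.∣ p ℚ.- q ∣ ℚ.+ ℚ.∣ q ℚ.- r ∣
∣p-r∣≤∣p-q∣+∣q-r∣ p q r = ℚ.≤-trans
  (ℚ.≤-reflexive (cong ℚ.∣_∣
    (solve 3 (λ p q r → p :- r := (p :- q) :+ (q :- r)) ≡.refl p q r)))
  (ℚ.∣p+q∣≤∣p∣+∣q∣ (p ℚ.- q) (q ℚ.- r))

p≤∣p∣ : ∀ p → p ℚ.≤ ℚ.∣ p ∣
p≤∣p∣ p with ℚ.≤-total 0ℚ p
... | inj₁ 0≤p = ℚ.≤-reflexive (≡.sym (ℚ.0≤p⇒∣p∣≡p 0≤p))
... | inj₂ p≤0 = ℚ.≤-trans p≤0 (ℚ.0≤∣p∣ p)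

∣p∣*∣p∣≡p*p : ∀ p → ℚ.∣ p ∣ ℚ.* ℚ.∣ p ∣ ≡ p ℚ.* p
∣p∣*∣p∣≡p*p p with ℚ.∣p∣≡p∨∣p∣≡-p p
... | inj₁ eq = cong₂ ℚ._*_ eq eq
... | inj₂ eq = ≡.trans (cong₂ ℚ._*_ eq eq) (solve 1 (λ p → :- p :* :- p := p :* p) ≡.refl p)

*-mono-≤-nonNeg : ∀ {p q r s} → 0ℚ ℚ.≤ p → 0ℚ ℚ.≤ r → p ℚ.≤ q → r ℚ.≤ s → p ℚ.* r ℚ.≤ q ℚ.* s
*-mono-≤-nonNeg {p} {q} {r} {s} 0≤p 0≤r p≤q r≤s = ℚ.≤-trans
  (ℚ.*-monoʳ-≤-nonNeg r {{ℚ.nonNegative 0≤r}} p≤q)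
  (ℚ.*-monoˡ-≤-nonNeg q {{ℚ.nonNegative (ℚ.≤-trans 0≤p p≤q)}} r≤s)

0≤p*p : ∀ p → 0ℚ ℚ.≤ p ℚ.* p
0≤p*p p = ℚ.≤-trans
  (*-mono-≤-nonNeg ℚ.≤-refl ℚ.≤-refl (ℚ.0≤∣p∣ p) (ℚ.0≤∣p∣ p))
  (ℚ.≤-reflexive (∣p∣*∣p∣≡p*p p))

p≤p+q : ∀ p {q} → 0ℚ ℚ.≤ q → p ℚ.≤ p ℚ.+ q
p≤p+q p {q} 0≤q = subst (ℚ._≤ p ℚ.+ q) (ℚ.+-identityʳ p) (ℚ.+-monoʳ-≤ p 0≤q)

p≤q+p : ∀ p {q} → 0ℚ ℚ.≤ q → p ℚ.≤ q ℚ.+ p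
p≤q+p p {q} 0≤q = subst (ℚ._≤ q ℚ.+ p) (ℚ.+-identityˡ p) (ℚ.+-monoˡ-≤ p 0≤q)

≈ᴿ-sym : ∀ {x y} → x ≈ᴿ y → y ≈ᴿ x
≈ᴿ-sym {x} {y} (mk≈ h) = mk≈ λ ε 0<ε → eventually-map
  (λ i → subst (ℚ._< ε) (∣p-q∣≡∣q-p∣ (seq x i) (seq y i))) (h ε 0<ε)

≈ᴿ-trans : ∀ {x y z} → x ≈ᴿ y → y ≈ᴿ z → x ≈ᴿ z
≈ᴿ-trans {x} {y} {z} (mk≈ h) (mk≈ k) = mk≈ λ ε 0<ε → eventually-zip
  (λ i p q → subst (ℚ.∣ seq x i ℚ.- seq z i ∣ ℚ.<_) (halves ε)
    (ℚ.≤-<-trans (∣p-r∣≤∣p-q∣+∣q-r∣ (seq x i) (seq y i) (seq z i)) (ℚ.+-mono-< p q)))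
  (h _ (half-pos 0<ε)) (k _ (half-pos 0<ε))

opaque
  unfolding _+ᴿ_ -ᴿ_ _*ᴿ_ inverseᴿ

  +ᴿ-cong : ∀ {x x′ y y′} → x ≈ᴿ x′ → y ≈ᴿ y′ → x +ᴿ y ≈ᴿ x′ +ᴿ y′
  +ᴿ-cong {x} {x′} {y} {y′} (mk≈ h) (mk≈ k) = mk≈ λ ε 0<ε → eventually-zip
    (λ i p q → subst (ℚ.∣ (seq x i ℚ.+ seq y i) ℚ.- (seq x′ i ℚ.+ seq y′ i) ∣ ℚ.<_) (halves ε)
      (ℚ.≤-<-trans
        (ℚ.≤-trans
          (ℚ.≤-reflexive (cong ℚ.∣_∣ (solve 4 (λ a b c d →
            (a :+ b) :- (c :+ d) := (a :- c) :+ (b :- d)) ≡.refl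
            (seq x i) (seq y i) (seq x′ i) (seq y′ i))))
          (ℚ.∣p+q∣≤∣p∣+∣q∣ (seq x i ℚ.- seq x′ i) (seq y i ℚ.- seq y′ i)))
        (ℚ.+-mono-< p q)))
    (h _ (half-pos 0<ε)) (k _ (half-pos 0<ε))

  -ᴿ-cong : ∀ {x y} → x ≈ᴿ y → -ᴿ x ≈ᴿ -ᴿ y
  -ᴿ-cong {x} {y} (mk≈ h) = mk≈ λ ε 0<ε → eventually-map
    (λ i → subst (ℚ._< ε)
      (≡.trans (∣p-q∣≡∣q-p∣ (seq x i) (seq y i))
        (cong ℚ.∣_∣ (solve 2 (λ a b → b :- a := :- a :- :- b) ≡.refl (seq x i) (seq y i)))))
    (h ε 0<ε)

  *ᴿ-cong : ∀ {x x′ y y′} → x ≈ᴿ x′ → y ≈ᴿ y′ → x *ᴿ y ≈ᴿ x′ *ᴿ y′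
  *ᴿ-cong {x} {x′} {y} {y′} (mk≈ h) (mk≈ k) = mk≈ λ ε 0<ε →
    -- `*-close` splits the difference as `x (y - y′) + y′ (x - x′)`, which is why the bounds are
    -- those of `x` and `y′`.
    let A , 0<A , bx = bounded (cauchy x)
        B , 0<B , by = bounded (cauchy y′)
    in eventually-zip
      (λ i (a , b) (p , q) →
        *-close (seq x i) (seq y i) (seq x′ i) (seq y′ i) 0<A 0<B a b p q)
      (eventually-zip (λ _ → _,_) bx by)
      (eventually-zip (λ _ → _,_)
        (k (recip A ℚ.* (ε ℚ.* ½)) (*-pos (recip-pos 0<A) (half-pos 0<ε)))
        (h (recip B ℚ.* (ε ℚ.* ½)) (*-pos (recip-pos 0<B) (half-pos 0<ε))))

  *ᴿ-inverseʳ : ∀ x 0<x → x *ᴿ inverseᴿ x 0<x ≈ᴿ fromℚᴿ 1ℚ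
  *ᴿ-inverseʳ x (mk< δ 0<δ N h) = ≈ᴿ-eventually (N , λ i N≤i →
    recip-inverse (ℚ.<-≤-trans 0<δ (subst (ℚ._≤ seq x i) (ℚ.+-identityˡ δ) (h i N≤i))))

-- Half of the gap absorbs the eventual difference between `x` and `x′`; the other half is the new
-- gap.
<ᴿ-respˡ-≈ᴿ : ∀ {x x′ y} → x ≈ᴿ x′ → x <ᴿ y → x′ <ᴿ y
<ᴿ-respˡ-≈ᴿ {x} {x′} {y} (mk≈ h) (mk< δ 0<δ M k) =
  let N , p = eventually-zip (λ i → step i) (h _ (half-pos 0<δ)) (M , k)
  in mk< (δ ℚ.* ½) (half-pos 0<δ) N p
  where
  open ℚ.≤-Reasoning
  step : ∀ i → ℚ.∣ seq x i ℚ.- seq x′ i ∣ ℚ.< δ ℚ.* ½ → seq x i ℚ.+ δ ℚ.≤ seq y i →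
    seq x′ i ℚ.+ δ ℚ.* ½ ℚ.≤ seq y i
  step i p q = begin
    seq x′ i ℚ.+ δ ℚ.* ½
      ≡⟨ solve 3 (λ a b c → b :+ c := a :+ ((b :- a) :+ c)) ≡.refl (seq x i) (seq x′ i) (δ ℚ.* ½) ⟩
    seq x i ℚ.+ ((seq x′ i ℚ.- seq x i) ℚ.+ δ ℚ.* ½)
      ≤⟨ ℚ.+-monoʳ-≤ (seq x i) (ℚ.+-monoˡ-≤ (δ ℚ.* ½)
           (ℚ.≤-trans (p≤∣p∣ (seq x′ i ℚ.- seq x i))
             (ℚ.≤-trans (ℚ.≤-reflexive (∣p-q∣≡∣q-p∣ (seq x′ i) (seq x i))) (ℚ.<⇒≤ p)))) ⟩
    seq x i ℚ.+ (δ ℚ.* ½ ℚ.+ δ ℚ.* ½)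
      ≡⟨ cong (seq x i ℚ.+_) (halves δ) ⟩
    seq x i ℚ.+ δ
      ≤⟨ q ⟩
    seq y i ∎

-- A single entry `seq x N`, taken where the tail varies by less than ε/4, decides the matter, since
-- comparison of rationals is decidable. If its modulus is below ε/2, the whole tail is below ε.
-- Otherwise the tail stays at least ε/4 away from 0, so `y` is eventually at least (ε/4)² and hence
-- positive, a contradiction.
≮0⇒root≈0 : ∀ {x y} → (∀ i → seq x i ℚ.* seq x i ℚ.≤ seq y i) → ¬ (0ᴿ <ᴿ y) → x ≈ᴿ 0ᴿ
≮0⇒root≈0 {x} {y} x²≤y y≯0 = mk≈ λ ε 0<ε →
  let h   = ε ℚ.* ½
      k   = h ℚ.* ½
      0<h = half-pos 0<ε
      0<k = half-pos 0<h
      N , c = cauchy x k 0<k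
      small : ℚ.∣ seq x N ∣ ℚ.< h → ∀ i → N ℕ.≤ i → ℚ.∣ seq x i ℚ.- 0ℚ ∣ ℚ.< ε
      small xN<h i N≤i = begin-strict
        ℚ.∣ seq x i ℚ.- 0ℚ ∣
          ≤⟨ ∣p-r∣≤∣p-q∣+∣q-r∣ (seq x i) (seq x N) 0ℚ ⟩
        ℚ.∣ seq x i ℚ.- seq x N ∣ ℚ.+ ℚ.∣ seq x N ℚ.- 0ℚ ∣
          <⟨ ℚ.+-mono-< (c i N N≤i ℕ.≤-refl)
               (subst (ℚ._< h) (cong ℚ.∣_∣ (≡.sym (ℚ.+-identityʳ (seq x N)))) xN<h) ⟩
        k ℚ.+ h
          <⟨ ℚ.+-monoˡ-< h (subst (k ℚ.<_) (halves h)
               (subst (ℚ._< k ℚ.+ k) (ℚ.+-identityʳ k) (ℚ.+-monoʳ-< k 0<k))) ⟩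
        h ℚ.+ h
          ≡⟨ halves ε ⟩
        ε ∎
      large : h ℚ.≤ ℚ.∣ seq x N ∣ → ∀ i → N ℕ.≤ i → 0ℚ ℚ.+ k ℚ.* k ℚ.≤ seq y i
      large h≤xN i N≤i =
        let k≤xi = ℚ.≮⇒≥ λ xi<k → ℚ.<-irrefl ≡.refl (begin-strict
              h
                ≤⟨ h≤xN ⟩
              ℚ.∣ seq x N ∣
                ≡⟨ cong ℚ.∣_∣ (solve 2 (λ a b → a := (a :- b) :+ b) ≡.refl (seq x N) (seq x i)) ⟩
              ℚ.∣ (seq x N ℚ.- seq x i) ℚ.+ seq x i ∣
                ≤⟨ ℚ.∣p+q∣≤∣p∣+∣q∣ (seq x N ℚ.- seq x i) (seq x i) ⟩
              ℚ.∣ seq x N ℚ.- seq x i ∣ ℚ.+ ℚ.∣ seq x i ∣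
                <⟨ ℚ.+-mono-< (c N i ℕ.≤-refl N≤i) xi<k ⟩
              k ℚ.+ k
                ≡⟨ halves h ⟩
              h ∎)
            0≤k = ℚ.<⇒≤ 0<k
        in begin
          0ℚ ℚ.+ k ℚ.* k                    ≡⟨ ℚ.+-identityˡ (k ℚ.* k) ⟩
          k ℚ.* k                           ≤⟨ *-mono-≤-nonNeg 0≤k 0≤k k≤xi k≤xi ⟩
          ℚ.∣ seq x i ∣ ℚ.* ℚ.∣ seq x i ∣   ≡⟨ ∣p∣*∣p∣≡p*p (seq x i) ⟩
          seq x i ℚ.* seq x i               ≤⟨ x²≤y i ⟩
          seq y i                           ∎
  in case h ℚ.≤? ℚ.∣ seq x N ∣ of λ where
    (yes h≤xN) → contradiction (mk< (k ℚ.* k) (*-pos 0<k 0<k) N (large h≤xN)) y≯0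
    (no  h≰xN) → N , small (ℚ.≰⇒> h≰xN)
  where open ℚ.≤-Reasoning

-- Complex numbers

≈-isEquivalence : IsEquivalence _≈_
≈-isEquivalence = record
  { refl  = ≈ᴿ-refl , ≈ᴿ-refl
  ; sym   = λ (p , q) → ≈ᴿ-sym p , ≈ᴿ-sym q
  ; trans = λ (p , q) (r , s) → ≈ᴿ-trans p r , ≈ᴿ-trans q s
  }

≈-setoid : Setoid 0ℓ 0ℓ
≈-setoid = record { isEquivalence = ≈-isEquivalence }

≈-pointwise : ∀ {z w} → (∀ i → seq (re z) i ≡ seq (re w) i) →
  (∀ i → seq (im z) i ≡ seq (im w) i) → z ≈ w
≈-pointwise p q = ≈ᴿ-pointwise p , ≈ᴿ-pointwise q

opaque
  unfolding _+ᴿ_ -ᴿ_ _*ᴿ_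

  -- With the real operations unfolded, each ring axiom is a polynomial identity between the
  -- rational entries at every index.
  +-assoc : ∀ u v w → (u + v) + w ≈ u + (v + w)
  +-assoc u v w = ≈-pointwise
    (λ i → ℚ.+-assoc (seq (re u) i) (seq (re v) i) (seq (re w) i))
    (λ i → ℚ.+-assoc (seq (im u) i) (seq (im v) i) (seq (im w) i))

  +-comm : ∀ z w → z + w ≈ w + z
  +-comm z w = ≈-pointwise
    (λ i → ℚ.+-comm (seq (re z) i) (seq (re w) i))
    (λ i → ℚ.+-comm (seq (im z) i) (seq (im w) i))

  +-identityˡ : ∀ z → fromℕ 0 + z ≈ z
  +-identityˡ z = ≈-pointwise
    (λ i → ℚ.+-identityˡ (seq (re z) i)) (λ i → ℚ.+-identityˡ (seq (im z) i))

  -‿inverseˡ : ∀ z → - z + z ≈ fromℕ 0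
  -‿inverseˡ z = ≈-pointwise
    (λ i → ℚ.+-inverseˡ (seq (re z) i)) (λ i → ℚ.+-inverseˡ (seq (im z) i))

  *-assoc : ∀ u v w → (u * v) * w ≈ u * (v * w)
  *-assoc u v w = ≈-pointwise
    (λ i → solve 6 (λ a b c d e f →
        (a :* c :- b :* d) :* e :- (a :* d :+ b :* c) :* f
        := a :* (c :* e :- d :* f) :- b :* (c :* f :+ d :* e)) ≡.refl
      (seq (re u) i) (seq (im u) i) (seq (re v) i) (seq (im v) i) (seq (re w) i) (seq (im w) i))
    (λ i → solve 6 (λ a b c d e f →
        (a :* c :- b :* d) :* f :+ (a :* d :+ b :* c) :* e
        := a :* (c :* f :+ d :* e) :+ b :* (c :* e :- d :* f)) ≡.refl
      (seq (re u) i) (seq (im u) i) (seq (re v) i) (seq (im v) i) (seq (re w) i) (seq (im w) i))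

  *-comm : ∀ z w → z * w ≈ w * z
  *-comm z w = ≈-pointwise
    (λ i → solve 4 (λ a b c d → a :* c :- b :* d := c :* a :- d :* b) ≡.refl
      (seq (re z) i) (seq (im z) i) (seq (re w) i) (seq (im w) i))
    (λ i → solve 4 (λ a b c d → a :* d :+ b :* c := c :* b :+ d :* a) ≡.refl
      (seq (re z) i) (seq (im z) i) (seq (re w) i) (seq (im w) i))

  *-identityˡ : ∀ z → fromℕ 1 * z ≈ z
  *-identityˡ z = ≈-pointwise
    (λ i → solve 2 (λ a b → con 1ℚ :* a :- con 0ℚ :* b := a) ≡.refl (seq (re z) i) (seq (im z) i))
    (λ i → solve 2 (λ a b → con 1ℚ :* b :+ con 0ℚ :* a := b) ≡.refl (seq (re z) i) (seq (im z) i))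

  *-distribˡ-+ : ∀ u v w → u * (v + w) ≈ u * v + u * w
  *-distribˡ-+ u v w = ≈-pointwise
    (λ i → solve 6 (λ a b c d e f →
        a :* (c :+ e) :- b :* (d :+ f) := (a :* c :- b :* d) :+ (a :* e :- b :* f)) ≡.refl
      (seq (re u) i) (seq (im u) i) (seq (re v) i) (seq (im v) i) (seq (re w) i) (seq (im w) i))
    (λ i → solve 6 (λ a b c d e f →
        a :* (d :+ f) :+ b :* (c :+ e) := (a :* d :+ b :* c) :+ (a :* f :+ b :* e)) ≡.refl
      (seq (re u) i) (seq (im u) i) (seq (re v) i) (seq (im v) i) (seq (re w) i) (seq (im w) i))

ℂ-commutativeRing : CommutativeRing 0ℓ 0ℓ
ℂ-commutativeRing = record
  { isCommutativeRing = record
    { isRing = record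
      { +-isAbelianGroup = record
        { isGroup = record
          { isMonoid = record
            { isSemigroup = record
              { isMagma = record
                { isEquivalence = ≈-isEquivalence
                ; ∙-cong = λ (p , q) (r , s) → +ᴿ-cong p r , +ᴿ-cong q s
                }
              ; assoc = +-assoc
              }
            ; identity = comm∧idˡ⇒id +-comm +-identityˡ
            }
          ; inverse = comm∧invˡ⇒inv +-comm -‿inverseˡ
          ; ⁻¹-cong = λ (p , q) → -ᴿ-cong p , -ᴿ-cong q
          }
        ; comm = +-comm
        }
      ; *-cong = λ (p , q) (r , s) →
          +ᴿ-cong (*ᴿ-cong p r) (-ᴿ-cong (*ᴿ-cong q s)) , +ᴿ-cong (*ᴿ-cong p s) (*ᴿ-cong q r)
      ; *-assoc = *-assoc
      ; *-identity = comm∧idˡ⇒id *-comm *-identityˡ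
      ; distrib = comm∧distrˡ⇒distr +-cong *-comm *-distribˡ-+
      }
    ; *-comm = *-comm
    }
  }
  where
  open import Algebra.Consequences.Setoid ≈-setoid
  +-cong : ∀ {u v w z} → u ≈ v → w ≈ z → u + w ≈ v + z
  +-cong (p , q) (r , s) = +ᴿ-cong p r , +ᴿ-cong q s

open CommutativeRing ℂ-commutativeRing
  using ( +-cong; +-congˡ; +-identityʳ; -‿cong; -‿inverseʳ; +-group; +-commutativeMonoid
        ; *-cong; *-congˡ; *-congʳ; *-identityʳ; zeroʳ; *-commutativeMonoid
        ; semiring; commutativeSemiring )
  renaming (refl to ≈-refl; sym to ≈-sym; trans to ≈-trans; reflexive to ≈-reflexive)

open import Algebra.Properties.Group +-group using (∙-cancelʳ)
open import Algebra.Properties.CommutativeSemiring.Exp commutativeSemiring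
  using (^-congˡ; ^-congʳ; ^-homo-*; ^-assocʳ; ^-distrib-*)
open import Algebra.Properties.Semiring.Sum semiring
  using (sum-cong-≋; sum-replicate-zero; sum-init-last; ∑-comm; *-distribˡ-sum)
open import Algebra.Properties.CommutativeMonoid.Sum *-commutativeMonoid
  using ()
  renaming (sum-cong-≋ to product-cong; ∑-comm to product-comm; ∑-distrib-+ to product-distrib-*)
import Algebra.Solver.CommutativeMonoid *-commutativeMonoid as *-Solver
import Relation.Binary.Reasoning.Setoid ≈-setoid as ≈-Reasoning

opaque
  unfolding _+ᴿ_ -ᴿ_ _*ᴿ_

  -- An arbitrary `r` in place of the inverse of `∣ z ∣²` keeps this and `im-*-inverse` polynomial
  -- identities; the reciprocal enters only through `*ᴿ-inverseʳ`.
  re-*-inverse : ∀ z r → re (z * mkℂ (re z *ᴿ r) ((-ᴿ im z) *ᴿ r)) ≈ᴿ ∣ z ∣² *ᴿ r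
  re-*-inverse z r = ≈ᴿ-pointwise λ i → solve 3 (λ a b r →
    a :* (a :* r) :- b :* (:- b :* r) := (a :* a :+ b :* b) :* r) ≡.refl
    (seq (re z) i) (seq (im z) i) (seq r i)

  im-*-inverse : ∀ z r → im (z * mkℂ (re z *ᴿ r) ((-ᴿ im z) *ᴿ r)) ≈ᴿ 0ᴿ
  im-*-inverse z r = ≈ᴿ-pointwise λ i → solve 3 (λ a b r →
    a :* (:- b :* r) :+ b :* (a :* r) := con 0ℚ) ≡.refl
    (seq (re z) i) (seq (im z) i) (seq r i)

*-inverseʳ : ∀ z z#0 → z * inverse z z#0 ≈ fromℕ 1
*-inverseʳ z z#0 =
  ≈ᴿ-trans (re-*-inverse z r) (*ᴿ-inverseʳ ∣ z ∣² (#⇒∣-∣²-pos z#0)) , im-*-inverse z r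
  where r = inverseᴿ ∣ z ∣² (#⇒∣-∣²-pos z#0)

opaque
  unfolding _+ᴿ_ -ᴿ_ _*ᴿ_

  -- Tightness of apartness from 0: both `re z` and `im z` have squares bounded by `∣ z ∣²`, so each
  -- of them vanishes once `∣ z ∣²` cannot be positive.
  ¬#0⇒≈0 : ∀ {z} → ¬ (z # fromℕ 0) → z ≈ fromℕ 0
  ¬#0⇒≈0 {z} ¬z#0 = ≮0⇒root≈0 re² ∣z∣²≯0 , ≮0⇒root≈0 im² ∣z∣²≯0
    where
    ∣z∣²≯0 : ¬ (0ᴿ <ᴿ ∣ z ∣²)
    ∣z∣²≯0 h = ¬z#0 (∣-∣²-pos⇒# h)
    re² : ∀ i → seq (re z) i ℚ.* seq (re z) i ℚ.≤ seq ∣ z ∣² i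
    re² i = p≤p+q _ (0≤p*p (seq (im z) i))
    im² : ∀ i → seq (im z) i ℚ.* seq (im z) i ℚ.≤ seq ∣ z ∣² i
    im² i = p≤q+p _ (0≤p*p (seq (re z) i))

-- The negative hypothesis on ω gives no inverse of ω - 1, so it is g that is
-- inverted, under the assumption g # 0.
*-cancelʳ-1 : ∀ ω g → ω * g ≈ g → ¬ (ω ≈ fromℕ 1) → g ≈ fromℕ 0
*-cancelʳ-1 ω g ωg≈g ω≉1 = ¬#0⇒≈0 λ g#0 → ω≉1 (begin
  ω                        ≈⟨ *-identityʳ ω ⟨
  ω * fromℕ 1              ≈⟨ *-congˡ (*-inverseʳ g g#0) ⟨
  ω * (g * inverse g g#0)  ≈⟨ *-assoc ω g (inverse g g#0) ⟨
  ω * g * inverse g g#0    ≈⟨ *-congʳ ωg≈g ⟩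
  g * inverse g g#0        ≈⟨ *-inverseʳ g g#0 ⟩
  fromℕ 1                  ∎)
  where open ≈-Reasoning

divide-cong : ∀ u v w z v#0 z#0 → u * z ≈ w * v → u * inverse v v#0 ≈ w * inverse z z#0
divide-cong u v w z v#0 z#0 uz≈wv = begin
  u * v⁻¹               ≈⟨ *-identityʳ (u * v⁻¹) ⟨
  u * v⁻¹ * fromℕ 1     ≈⟨ *-congˡ (*-inverseʳ z z#0) ⟨
  u * v⁻¹ * (z * z⁻¹)   ≈⟨ *-Solver.solve 4 (λ u v z z′ → (u ⊕ v) ⊕ (z ⊕ z′) ⊜ (u ⊕ z) ⊕ (v ⊕ z′)) ≈-refl u v⁻¹ z z⁻¹ ⟩
  u * z * (v⁻¹ * z⁻¹)   ≈⟨ *-congʳ uz≈wv ⟩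
  w * v * (v⁻¹ * z⁻¹)   ≈⟨ *-Solver.solve 4 (λ w v v′ z → (w ⊕ v) ⊕ (v′ ⊕ z) ⊜ (w ⊕ z) ⊕ (v ⊕ v′)) ≈-refl w v v⁻¹ z⁻¹ ⟩
  w * z⁻¹ * (v * v⁻¹)   ≈⟨ *-congˡ (*-inverseʳ v v#0) ⟩
  w * z⁻¹ * fromℕ 1     ≈⟨ *-identityʳ (w * z⁻¹) ⟩
  w * z⁻¹               ∎
  where
  open ≈-Reasoning
  open *-Solver using (_⊕_; _⊜_)
  v⁻¹ = inverse v v#0
  z⁻¹ = inverse z z#0

-- Limits

infix 4 _⟶_

-- `t SumsTo s` is by definition `partialSum t ⟶ s`, so the limit laws apply to series directly.
_⟶_ : (ℕ → ℂ) → ℂ → Set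
u ⟶ s = ∀ ε → 0ℚ ℚ.< ε → Eventually λ p → ∣ u p - s ∣² <ᴿ fromℚᴿ (ε ℚ.* ε)

∣-∣²-cong : ∀ {z w} → z ≈ w → ∣ z ∣² ≈ᴿ ∣ w ∣²
∣-∣²-cong (p , q) = +ᴿ-cong (*ᴿ-cong p p) (*ᴿ-cong q q)

⟶-cong : ∀ {u v s t} → (∀ p → u p ≈ v p) → s ≈ t → u ⟶ s → v ⟶ t
⟶-cong {u} {v} {s} {t} u≈v s≈t h ε 0<ε = eventually-map
  (λ p → <ᴿ-respˡ-≈ᴿ (∣-∣²-cong {u p - s} {v p - t} (+-cong (u≈v p) (-‿cong s≈t)))) (h ε 0<ε)

-- Serves to restrict to partial sums of length `p * n`, which consist of complete residue blocks
-- modulo `n`.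
⟶-subsequence : ∀ {u s} (f : ℕ → ℕ) → (∀ p → p ℕ.≤ f p) → u ⟶ s → (λ p → u (f p)) ⟶ s
⟶-subsequence f p≤fp h ε 0<ε =
  let N , k = h ε 0<ε in N , λ p N≤p → k (f p) (ℕ.≤-trans N≤p (p≤fp p))

-- Parallelogram law: ∣z + w∣² + ∣z - w∣² = 2 ∣z∣² + 2 ∣w∣².
normℚ-+-≤ : ∀ a b c d ε {g h} → 0ℚ ℚ.< g → 0ℚ ℚ.< h →
  normℚ a b ℚ.+ g ℚ.≤ (ε ℚ.* ½) ℚ.* (ε ℚ.* ½) →
  normℚ c d ℚ.+ h ℚ.≤ (ε ℚ.* ½) ℚ.* (ε ℚ.* ½) →
  normℚ (a ℚ.+ c) (b ℚ.+ d) ℚ.+ (g ℚ.+ h) ℚ.≤ ε ℚ.* ε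
normℚ-+-≤ a b c d ε {g} {h} 0<g 0<h p q = begin
  normℚ (a ℚ.+ c) (b ℚ.+ d) ℚ.+ (g ℚ.+ h)
    -- The added term is the squared norm of the difference with a second copy of the gap, so that
    -- the total is two copies of each hypothesis. The resulting four copies of (ε/2)² make ε².
    ≤⟨ p≤p+q _ (ℚ.+-mono-≤ (ℚ.+-mono-≤ (0≤p*p (a ℚ.- c)) (0≤p*p (b ℚ.- d)))
         (ℚ.<⇒≤ (ℚ.+-mono-< 0<g 0<h))) ⟩
  (normℚ (a ℚ.+ c) (b ℚ.+ d) ℚ.+ (g ℚ.+ h)) ℚ.+ (normℚ (a ℚ.- c) (b ℚ.- d) ℚ.+ (g ℚ.+ h))
    ≡⟨ solve 6 (λ a b c d g h →
         ((a :+ c) :* (a :+ c) :+ (b :+ d) :* (b :+ d) :+ (g :+ h))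
           :+ (((a :- c) :* (a :- c) :+ (b :- d) :* (b :- d)) :+ (g :+ h))
         := (((a :* a :+ b :* b) :+ g) :+ ((a :* a :+ b :* b) :+ g))
           :+ (((c :* c :+ d :* d) :+ h) :+ ((c :* c :+ d :* d) :+ h))) ≡.refl a b c d g h ⟩
  ((normℚ a b ℚ.+ g) ℚ.+ (normℚ a b ℚ.+ g)) ℚ.+ ((normℚ c d ℚ.+ h) ℚ.+ (normℚ c d ℚ.+ h))
    ≤⟨ ℚ.+-mono-≤ (ℚ.+-mono-≤ p p) (ℚ.+-mono-≤ q q) ⟩
  (e ℚ.* e ℚ.+ e ℚ.* e) ℚ.+ (e ℚ.* e ℚ.+ e ℚ.* e)
    ≡⟨ solve 1 (λ e → e :* e :+ e :* e :+ (e :* e :+ e :* e) := (e :+ e) :* (e :+ e)) ≡.refl e ⟩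
  (e ℚ.+ e) ℚ.* (e ℚ.+ e)
    ≡⟨ cong₂ ℚ._*_ (halves ε) (halves ε) ⟩
  ε ℚ.* ε ∎
  where
  open ℚ.≤-Reasoning
  e = ε ℚ.* ½

opaque
  unfolding _+ᴿ_ -ᴿ_ _*ᴿ_

  ∣0∣²≈0 : ∣ fromℕ 0 ∣² ≈ᴿ 0ᴿ
  ∣0∣²≈0 = ≈ᴿ-pointwise λ _ → ≡.refl

  -- The triangle inequality in the form that squared moduli need, without square roots; the two
  -- gaps add up.
  ∣+∣²-< : ∀ {z w ε} → ∣ z ∣² <ᴿ fromℚᴿ ((ε ℚ.* ½) ℚ.* (ε ℚ.* ½)) →
    ∣ w ∣² <ᴿ fromℚᴿ ((ε ℚ.* ½) ℚ.* (ε ℚ.* ½)) → ∣ z + w ∣² <ᴿ fromℚᴿ (ε ℚ.* ε)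
  ∣+∣²-< {z} {w} {ε} (mk< g 0<g M p) (mk< h 0<h N q) =
    let K , k = eventually-zip
          (λ i → normℚ-+-≤ (seq (re z) i) (seq (im z) i) (seq (re w) i) (seq (im w) i) ε 0<g 0<h)
          (M , p) (N , q)
    in mk< (g ℚ.+ h) (ℚ.+-mono-< 0<g 0<h) K k

  -‿interchange : ∀ u v s t → (u - s) + (v - t) ≈ (u + v) - (s + t)
  -‿interchange u v s t = ≈-pointwise
    (λ i → solve 4 (λ a b c d → (a :- c) :+ (b :- d) := (a :+ b) :- (c :+ d)) ≡.refl
      (seq (re u) i) (seq (re v) i) (seq (re s) i) (seq (re t) i))
    (λ i → solve 4 (λ a b c d → (a :- c) :+ (b :- d) := (a :+ b) :- (c :+ d)) ≡.refl
      (seq (im u) i) (seq (im v) i) (seq (im s) i) (seq (im t) i))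

  -- The squared modulus scales by q², so the tolerance ε/q for `z` becomes ε and the gap is
  -- multiplied by q².
  ∣fromℚ*∣²-< : ∀ {z q ε} → 0ℚ ℚ.< q →
    ∣ z ∣² <ᴿ fromℚᴿ ((recip q ℚ.* ε) ℚ.* (recip q ℚ.* ε)) → ∣ fromℚ q * z ∣² <ᴿ fromℚᴿ (ε ℚ.* ε)
  ∣fromℚ*∣²-< {z} {q} {ε} 0<q (mk< g 0<g N h) =
    mk< ((q ℚ.* q) ℚ.* g) (*-pos (*-pos 0<q 0<q) 0<g) N λ i N≤i →
      let a = seq (re z) i
          b = seq (im z) i
      in ℚ.≤-trans
        (ℚ.≤-reflexive (solve 4 (λ q g a b →
            (q :* a :- con 0ℚ :* b) :* (q :* a :- con 0ℚ :* b)
              :+ (q :* b :+ con 0ℚ :* a) :* (q :* b :+ con 0ℚ :* a) :+ q :* q :* g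
            := (q :* q) :* ((a :* a :+ b :* b) :+ g)) ≡.refl q g a b))
        (ℚ.≤-trans
          (ℚ.*-monoˡ-≤-nonNeg (q ℚ.* q) {{ℚ.nonNegative (0≤p*p q)}} (h i N≤i))
          (ℚ.≤-reflexive (≡.trans
            (solve 3 (λ q r e → q :* q :* ((r :* e) :* (r :* e)) := (q :* (r :* e)) :* (q :* (r :* e)))
              ≡.refl q (recip q) ε)
            (cong₂ ℚ._*_ (cancel 0<q ε) (cancel 0<q ε)))))

  *-distribˡ-- : ∀ u v w → u * (v - w) ≈ u * v - u * w
  *-distribˡ-- u v w = ≈-pointwise
    (λ i → solve 6 (λ a b c d e f →
        a :* (c :- e) :- b :* (d :- f) := (a :* c :- b :* d) :- (a :* e :- b :* f)) ≡.refl
      (seq (re u) i) (seq (im u) i) (seq (re v) i) (seq (im v) i) (seq (re w) i) (seq (im w) i))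
    (λ i → solve 6 (λ a b c d e f →
        a :* (d :- f) :+ b :* (c :- e) := (a :* d :+ b :* c) :- (a :* f :+ b :* e)) ≡.refl
      (seq (re u) i) (seq (im u) i) (seq (re v) i) (seq (im v) i) (seq (re w) i) (seq (im w) i))

⟶-+ : ∀ {u v s t} → u ⟶ s → v ⟶ t → (λ p → u p + v p) ⟶ (s + t)
⟶-+ {u} {v} {s} {t} h k ε 0<ε = eventually-zip
  (λ p a b → <ᴿ-respˡ-≈ᴿ (∣-∣²-cong (-‿interchange (u p) (v p) s t))
    (∣+∣²-< {u p - s} {v p - t} {ε} a b))
  (h _ (half-pos 0<ε)) (k _ (half-pos 0<ε))

⟶-scale : ∀ {u s} q → 0ℚ ℚ.< q → u ⟶ s → (λ p → fromℚ q * u p) ⟶ (fromℚ q * s)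
⟶-scale {u} {s} q 0<q h ε 0<ε = eventually-map
  (λ p a → <ᴿ-respˡ-≈ᴿ (∣-∣²-cong (*-distribˡ-- (fromℚ q) (u p) s))
    (∣fromℚ*∣²-< {u p - s} {q} {ε} 0<q a))
  (h _ (*-pos (recip-pos 0<q) 0<ε))

⟶-0 : (λ _ → fromℕ 0) ⟶ fromℕ 0
⟶-0 ε 0<ε = 0 , λ _ _ → <ᴿ-respˡ-≈ᴿ
  (≈ᴿ-sym (≈ᴿ-trans (∣-∣²-cong {fromℕ 0 - fromℕ 0} {fromℕ 0} (-‿inverseʳ (fromℕ 0))) ∣0∣²≈0))
  (mk< (ε ℚ.* ε) (*-pos 0<ε 0<ε) 0 λ _ _ → ℚ.≤-reflexive (ℚ.+-identityˡ (ε ℚ.* ε)))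

⟶-sum : ∀ {k} {u : Fin k → ℕ → ℂ} {s} → (∀ l → u l ⟶ s l) → (λ p → sum λ l → u l p) ⟶ sum s
⟶-sum {ℕ.zero}  h = ⟶-0
⟶-sum {ℕ.suc k} h = ⟶-+ (h zero) (⟶-sum λ l → h (suc l))

-- Finite sums and products

module _ {c ℓ} (M : CommutativeMonoid c ℓ) where

  open CommutativeMonoid M renaming (_≈_ to _≈ᴹ_)
  open import Algebra.Properties.CommutativeMonoid.Sum M
    using () renaming (sum to sumᴹ; sum-cong-≋ to sumᴹ-cong)

  -- The monoid is arbitrary because indices are regrouped on both sides of the ring: additively for
  -- partial sums, multiplicatively for Pochhammer symbols.
  sum-split : ∀ j {k} (f : Vector Carrier (j ℕ.+ k)) →
    sumᴹ f ≈ᴹ sumᴹ (λ i → f (i Fin.↑ˡ k)) ∙ sumᴹ (λ i → f (j Fin.↑ʳ i))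
  sum-split ℕ.zero    f = sym (identityˡ (sumᴹ f))
  sum-split (ℕ.suc j) f = trans (∙-congˡ (sum-split j (λ i → f (suc i))))
    (sym (assoc _ _ _))

  sum-combine : ∀ j k (f : Vector Carrier (j ℕ.* k)) →
    sumᴹ f ≈ᴹ sumᴹ {j} λ i → sumᴹ {k} λ l → f (combine i l)
  sum-combine ℕ.zero    k f = refl
  sum-combine (ℕ.suc j) k f = trans (sum-split k f)
    (∙-congˡ (sum-combine j k (λ i → f (k Fin.↑ʳ i))))

  -- Division of the index by `k` with quotient `i` and remainder `l`.
  sum-blocks : ∀ j k (f : ℕ → Carrier) →
    sumᴹ {j ℕ.* k} (λ i → f (toℕ i)) ≈ᴹ sumᴹ {j} λ i → sumᴹ {k} λ l → f (k ℕ.* toℕ i ℕ.+ toℕ l)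
  sum-blocks j k f = trans (sum-combine j k (λ i → f (toℕ i)))
    (sumᴹ-cong {j} λ i → sumᴹ-cong {k} λ l → reflexive (cong f (Fin.toℕ-combine i l)))

open ≈-Reasoning

-- Pochhammer symbols and the coefficients of the series.

opaque
  unfolding _+ᴿ_ -ᴿ_ _*ᴿ_

  fromℚ-+ : ∀ p q → fromℚ (p ℚ.+ q) ≈ fromℚ p + fromℚ q
  fromℚ-+ p q = ≈-pointwise (λ _ → ≡.refl) (λ _ → ≡.refl)

  fromℚ-* : ∀ p q → fromℚ (p ℚ.* q) ≈ fromℚ p * fromℚ q
  fromℚ-* p q = ≈-pointwise
    (λ _ → solve 2 (λ p q → p :* q := p :* q :- con 0ℚ :* con 0ℚ) ≡.refl p q)
    (λ _ → solve 2 (λ p q → con 0ℚ := p :* con 0ℚ :+ con 0ℚ :* q) ≡.refl p q)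

fromℕ-suc : ∀ k → fromℕ (ℕ.suc k) ≈ fromℕ 1 + fromℕ k
fromℕ-suc k = begin
  fromℕ (ℕ.suc k)              ≡⟨ cong fromℚ eq ⟩
  fromℚ (1ℚ ℚ.+ (+ k ℚ./ 1))   ≈⟨ fromℚ-+ 1ℚ (+ k ℚ./ 1) ⟩
  fromℕ 1 + fromℕ k            ∎
  where
  eq : + ℕ.suc k ℚ./ 1 ≡ 1ℚ ℚ.+ (+ k ℚ./ 1)
  -- The case `n = 1`, `l = 1` of `shift-arith`, whose left side contains `1 * k` instead of `k`.
  eq = ≡.trans (cong (λ t → + ℕ.suc t ℚ./ 1) (≡.sym (ℕ.*-identityˡ k)))
    (≡.trans (shift-arith 1 1 k) (ℚ.*-identityˡ (1ℚ ℚ.+ (+ k ℚ./ 1))))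

-- One factor of the multiplication formula: factor number np + l of (na)_{nk} is n times factor
-- number p of (a + l/n)_k.
*-shift : ∀ n .{{_ : NonZero n}} a p l →
  fromℕ n * a + fromℕ (n ℕ.* p ℕ.+ l) ≈ fromℕ n * ((a + fromℚ (+ l ℚ./ n)) + fromℕ p)
*-shift n a p l = begin
  fromℕ n * a + fromℕ (n ℕ.* p ℕ.+ l)
    ≡⟨ cong (λ t → fromℕ n * a + fromℚ t)
         (≡.trans (cong (λ t → + t ℚ./ 1) (ℕ.+-comm (n ℕ.* p) l)) (shift-arith n l p)) ⟩
  fromℕ n * a + fromℚ ((+ n ℚ./ 1) ℚ.* (L ℚ.+ P))
    ≈⟨ +-congˡ {fromℕ n * a} (≈-trans (fromℚ-* (+ n ℚ./ 1) (L ℚ.+ P)) (*-congˡ {fromℕ n} (fromℚ-+ L P))) ⟩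
  fromℕ n * a + fromℕ n * (fromℚ L + fromℕ p)
    ≈⟨ *-distribˡ-+ (fromℕ n) a (fromℚ L + fromℕ p) ⟨
  fromℕ n * (a + (fromℚ L + fromℕ p))
    ≈⟨ *-congˡ {fromℕ n} (+-assoc a (fromℚ L) (fromℕ p)) ⟨
  fromℕ n * ((a + fromℚ L) + fromℕ p) ∎
  where
  L = + l ℚ./ n
  P = + p ℚ./ 1

-- The constant does not depend on c, so it cancels between the numerator and
-- the denominator of a hypergeometric term.
pochhammer-multiplication : ∀ n .{{_ : NonZero n}} {m} k (c : Vector ℂ m) →
  product (λ i → pochhammer (fromℕ n * c i) (k ℕ.* n))
    ≈ product {n} (λ l → product {m} λ i → product {k} λ p → fromℕ n)
      * product (λ j → pochhammer (shifts n c j) k)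
pochhammer-multiplication n {m} k c = begin
  product (λ i → pochhammer (fromℕ n * c i) (k ℕ.* n))
    ≈⟨ (product-cong {m} λ i → begin
         pochhammer (fromℕ n * c i) (k ℕ.* n)
           ≈⟨ sum-blocks *-commutativeMonoid k n (λ q → fromℕ n * c i + fromℕ q) ⟩
         product {k} (λ p → product {n} λ l → fromℕ n * c i + fromℕ (n ℕ.* toℕ p ℕ.+ toℕ l))
           ≈⟨ (product-cong {k} λ p → product-cong {n} λ l → *-shift n (c i) (toℕ p) (toℕ l)) ⟩
         product {k} (λ p → product {n} λ l → fromℕ n * x l i p)
           ≈⟨ product-comm {k} {n} (λ p l → fromℕ n * x l i p) ⟩
         product {n} (λ l → product {k} λ p → fromℕ n * x l i p) ∎) ⟩
  product {m} (λ i → product {n} λ l → product {k} λ p → fromℕ n * x l i p)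
    ≈⟨ product-comm {m} {n} (λ i l → product {k} λ p → fromℕ n * x l i p) ⟩
  product {n} (λ l → product {m} λ i → product {k} λ p → fromℕ n * x l i p)
    ≈⟨ (product-cong {n} λ l → ≈-trans
         (product-cong {m} λ i → product-distrib-* {k} (λ _ → fromℕ n) (x l i))
         (product-distrib-* {m} (λ _ → product {k} λ _ → fromℕ n) (λ i → product {k} (x l i)))) ⟩
  product {n} (λ l → product {m} (λ i → product {k} λ p → fromℕ n) * product {m} λ i → product {k} (x l i))
    ≈⟨ product-distrib-* {n} (λ _ → product {m} λ _ → product {k} λ _ → fromℕ n)
         (λ l → product {m} λ i → product {k} (x l i)) ⟩
  κ * product {n} (λ l → product {m} λ i → product {k} (x l i))
    -- `shifts` reads its index through `remQuot`, which undoes `combine`.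
    ≈⟨ *-congˡ {κ} (product-cong {n} λ l → product-cong {m} λ i → ≈-reflexive
         (cong (λ (l , i) → product {k} (x l i)) (Fin.remQuot-combine l i))) ⟨
  κ * product {n} (λ l → product {m} λ i → pochhammer (shifts n c (combine l i)) k)
    ≈⟨ *-congˡ {κ} (sum-combine *-commutativeMonoid n m (λ j → pochhammer (shifts n c j) k)) ⟨
  κ * product (λ j → pochhammer (shifts n c j) k) ∎
  where
  x : Fin n → Fin m → Fin k → ℂ
  x l i p = (c i + fromℚ (+ toℕ l ℚ./ n)) + fromℕ (toℕ p)
  κ = product {n} (λ l → product {m} λ i → product {k} λ p → fromℕ n)

-- `F-term a b hb z k` is by definition `F-coefficient a b hb k * z ^ k`. Thus the `n` series on the
-- left are one power series evaluated at `n` rotated points.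
F-coefficient : ∀ {m} (a b : Vector ℂ m) → (∀ i → NoNonPositiveInteger (b i)) → ℕ → ℂ
F-coefficient a b hb k =
  product (λ i → pochhammer (a i) k)
  * inverse (product (λ i → pochhammer (b i) k))
            (product-#0 _ (λ i → pochhammer-#0 (b i) (hb i) k))

-- Comparing cross products lets `κ` pass from the denominator's formula to the numerator's, so `κ`
-- itself is never inverted.
F-coefficient-shifts : ∀ n .{{_ : NonZero n}} {m} (a b : Vector ℂ m) hb k →
  F-coefficient (shifts n a) (shifts n b) (shifts-NoNonPositiveInteger n b hb) k
    ≈ F-coefficient (λ i → fromℕ n * a i) (λ i → fromℕ n * b i) hb (k ℕ.* n)
F-coefficient-shifts n {m} a b hb k = divide-cong (Q a) (Q b) (P a) (P b) _ _ (begin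
  Q a * P b        ≈⟨ *-congˡ {Q a} (pochhammer-multiplication n k b) ⟩
  Q a * (κ * Q b)  ≈⟨ *-Solver.solve 3 (λ x y z → x ⊕ (y ⊕ z) ⊜ (y ⊕ x) ⊕ z) ≈-refl (Q a) κ (Q b) ⟩
  κ * Q a * Q b    ≈⟨ *-congʳ {Q b} (pochhammer-multiplication n k a) ⟨
  P a * Q b        ∎)
  where
  open *-Solver using (_⊕_; _⊜_)
  P Q : Vector ℂ m → ℂ
  P c = product λ i → pochhammer (fromℕ n * c i) (k ℕ.* n)
  Q c = product λ j → pochhammer (shifts n c j) k
  κ = product {n} (λ l → product {m} λ i → product {k} λ p → fromℕ n)

-- Sums of powers of roots of unity

geometricSum : ℕ → ℂ → ℂ
geometricSum n ω = sum {n} λ l → ω ^ toℕ l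

-- Multiplication by `ω` raises every exponent by one: it drops the term 1 and gains `ω ^ n`, which
-- is again 1. After 1 is added, both sides are the geometric sum of n + 1 terms, opened at its
-- first and at its last term.
*-geometricSum : ∀ n ω → ω ^ n ≈ fromℕ 1 → ω * geometricSum n ω ≈ geometricSum n ω
*-geometricSum n ω ωⁿ≈1 = ∙-cancelʳ (fromℕ 1) _ _ (begin
  ω * geometricSum n ω + fromℕ 1
    ≈⟨ +-comm (ω * geometricSum n ω) (fromℕ 1) ⟩
  fromℕ 1 + ω * geometricSum n ω
    ≈⟨ +-congˡ {fromℕ 1} (*-distribˡ-sum {n} ω (λ l → ω ^ toℕ l)) ⟩
  geometricSum (ℕ.suc n) ω
    ≈⟨ sum-init-last {n} (λ l → ω ^ toℕ l) ⟩
  sum {n} (λ l → ω ^ toℕ (Fin.inject₁ l)) + ω ^ toℕ (Fin.fromℕ n)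
    ≈⟨ +-cong (sum-cong-≋ {n} λ l → ^-congʳ ω (Fin.toℕ-inject₁ l))
         (≈-trans (^-congʳ ω (Fin.toℕ-fromℕ n)) ωⁿ≈1) ⟩
  geometricSum n ω + fromℕ 1 ∎)

1^k≈1 : ∀ k → fromℕ 1 ^ k ≈ fromℕ 1
1^k≈1 ℕ.zero    = ≈-refl
1^k≈1 (ℕ.suc k) = ≈-trans (*-identityˡ (fromℕ 1 ^ k)) (1^k≈1 k)

geometricSum-1 : ∀ n {ω} → ω ≈ fromℕ 1 → geometricSum n ω ≈ fromℕ n
geometricSum-1 n {ω} ω≈1 = ≈-trans
  (sum-cong-≋ {n} λ l → ≈-trans (^-congˡ (toℕ l) ω≈1) (1^k≈1 (toℕ l))) (sum-1 n)
  where
  sum-1 : ∀ n → sum {n} (λ _ → fromℕ 1) ≈ fromℕ n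
  sum-1 ℕ.zero    = ≈-refl
  sum-1 (ℕ.suc n) = ≈-trans (+-congˡ {fromℕ 1} (sum-1 n)) (≈-sym (fromℕ-suc n))

module _ {n} {ξ} (ξ-primitive : IsPrimitiveRoot n ξ) where

  open IsPrimitiveRoot ξ-primitive

  ξ^nj≈1 : ∀ j → ξ ^ (n ℕ.* j) ≈ fromℕ 1
  ξ^nj≈1 j = begin
    ξ ^ (n ℕ.* j)  ≈⟨ ^-assocʳ ξ n j ⟨
    (ξ ^ n) ^ j    ≈⟨ ^-congˡ j ξⁿ≈1 ⟩
    fromℕ 1 ^ j    ≈⟨ 1^k≈1 j ⟩
    fromℕ 1        ∎

  ξ^nj+r≈ξ^r : ∀ j r → ξ ^ (n ℕ.* j ℕ.+ r) ≈ ξ ^ r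
  ξ^nj+r≈ξ^r j r = begin
    ξ ^ (n ℕ.* j ℕ.+ r)    ≈⟨ ^-homo-* ξ (n ℕ.* j) r ⟩
    ξ ^ (n ℕ.* j) * ξ ^ r  ≈⟨ *-congʳ {ξ ^ r} (ξ^nj≈1 j) ⟩
    fromℕ 1 * ξ ^ r        ≈⟨ *-identityˡ (ξ ^ r) ⟩
    ξ ^ r                  ∎

  -- The ratio `ω` satisfies `ω ^ n ≈ fromℕ 1`, so multiplication by `ω` fixes the sum; and `ω`
  -- equals `ξ ^ r`, which primitivity separates from 1. The exponent is given by quotient and
  -- remainder because primitivity speaks only of exponents below `n`.
  geometricSum-0 : ∀ j r → 0 ℕ.< r → r ℕ.< n → geometricSum n (ξ ^ (n ℕ.* j ℕ.+ r)) ≈ fromℕ 0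
  geometricSum-0 j r 0<r r<n = *-cancelʳ-1 ω (geometricSum n ω)
    (*-geometricSum n ω (begin
      ω ^ n                          ≈⟨ ^-assocʳ ξ q n ⟩
      ξ ^ (q ℕ.* n)                  ≡⟨ cong (ξ ^_) (ℕ.*-comm q n) ⟩
      ξ ^ (n ℕ.* q)                  ≈⟨ ξ^nj≈1 q ⟩
      fromℕ 1                        ∎))
    (λ ω≈1 → ξᵏ≉1 r 0<r r<n (≈-trans (≈-sym (ξ^nj+r≈ξ^r j r)) ω≈1))
    where
    q = n ℕ.* j ℕ.+ r
    ω = ξ ^ q

-- In a block of `n` consecutive exponents only the multiple of `n`, at remainder 0, survives, with
-- weight `n`. Writing `n` as a successor exposes that term as the head of the sum.
root-filter : ∀ {n} .{{_ : NonZero n}} {ξ} → IsPrimitiveRoot n ξ → ∀ (d : ℕ → ℂ) j →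
  sum {n} (λ r → d (n ℕ.* j ℕ.+ toℕ r) * geometricSum n (ξ ^ (n ℕ.* j ℕ.+ toℕ r)))
    ≈ fromℕ n * d (n ℕ.* j)
root-filter {n@(ℕ.suc n′)} {ξ} ξ-primitive d j = begin
  d (n ℕ.* j ℕ.+ 0) * geometricSum n (ξ ^ (n ℕ.* j ℕ.+ 0))
    + sum {n′} (λ r → d (q r) * geometricSum n (ξ ^ q r))
    ≈⟨ +-cong
         (*-cong {d (n ℕ.* j ℕ.+ 0)} (≈-reflexive (cong d (ℕ.+-identityʳ (n ℕ.* j))))
           (geometricSum-1 n (ξ^nj+r≈ξ^r ξ-primitive j 0)))
         (≈-trans
           (sum-cong-≋ {n′} λ r → ≈-trans
             (*-congˡ {d (q r)} (geometricSum-0 ξ-primitive j (ℕ.suc (toℕ r))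
               (ℕ.s≤s ℕ.z≤n) (ℕ.s≤s (Fin.toℕ<n r))))
             (zeroʳ (d (q r))))
           (sum-replicate-zero n′)) ⟩
  d (n ℕ.* j) * fromℕ n + fromℕ 0
    ≈⟨ +-identityʳ (d (n ℕ.* j) * fromℕ n) ⟩
  d (n ℕ.* j) * fromℕ n
    ≈⟨ *-comm (d (n ℕ.* j)) (fromℕ n) ⟩
  fromℕ n * d (n ℕ.* j) ∎
  where
  q : Fin n′ → ℕ
  q r = n ℕ.* j ℕ.+ ℕ.suc (toℕ r)

-- Extraction of every n-th term of a power series.

-- At length `p * n` the truncated sums consist of `p` full blocks, so the filter leaves no
-- remainder and the identity is exact for every `p`; only finite sums are interchanged.
sum-rotated-powerSeries : ∀ {n} .{{_ : NonZero n}} {ξ} → IsPrimitiveRoot n ξ →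
  ∀ (c : ℕ → ℂ) z p →
  sum {n} (λ l → partialSum (λ q → c q * (ξ ^ toℕ l * z) ^ q) (p ℕ.* n))
    ≈ fromℕ n * partialSum (λ j → c (j ℕ.* n) * (z ^ n) ^ j) p
sum-rotated-powerSeries {n} {ξ} ξ-primitive c z p = begin
  sum {n} (λ l → sum {p ℕ.* n} λ q → t l (toℕ q))
    ≈⟨ ∑-comm {n} {p ℕ.* n} (λ l q → t l (toℕ q)) ⟩
  sum {p ℕ.* n} (λ q → sum {n} λ l → t l (toℕ q))
    ≈⟨ (sum-cong-≋ {p ℕ.* n} λ q → filter (toℕ q)) ⟩
  sum {p ℕ.* n} (λ q → d (toℕ q) * geometricSum n (ξ ^ toℕ q))
    ≈⟨ sum-blocks +-commutativeMonoid p n (λ q → d q * geometricSum n (ξ ^ q)) ⟩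
  sum {p} (λ j → sum {n} λ r → d (n ℕ.* toℕ j ℕ.+ toℕ r) * geometricSum n (ξ ^ (n ℕ.* toℕ j ℕ.+ toℕ r)))
    ≈⟨ (sum-cong-≋ {p} λ j → root-filter ξ-primitive d (toℕ j)) ⟩
  sum {p} (λ j → fromℕ n * d (n ℕ.* toℕ j))
    ≈⟨ *-distribˡ-sum {p} (fromℕ n) (λ j → d (n ℕ.* toℕ j)) ⟨
  fromℕ n * sum {p} (λ j → d (n ℕ.* toℕ j))
    ≈⟨ *-congˡ {fromℕ n} (sum-cong-≋ {p} λ j → *-cong
         {c (n ℕ.* toℕ j)} (≈-reflexive (cong c (ℕ.*-comm n (toℕ j)))) (≈-sym (^-assocʳ z n (toℕ j)))) ⟩
  fromℕ n * partialSum (λ j → c (j ℕ.* n) * (z ^ n) ^ j) p ∎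
  where
  open *-Solver using (_⊕_; _⊜_)
  t : Fin n → ℕ → ℂ
  t l q = c q * (ξ ^ toℕ l * z) ^ q
  d : ℕ → ℂ
  d q = c q * z ^ q
  -- Since `(ξ ^ l) ^ q` equals `(ξ ^ q) ^ l`, the sum over the rotations is geometric with ratio
  -- `ξ ^ q`.
  filter : ∀ q → sum {n} (λ l → t l q) ≈ d q * geometricSum n (ξ ^ q)
  filter q = begin
    sum {n} (λ l → t l q)
      ≈⟨ (sum-cong-≋ {n} λ l → begin
           c q * (ξ ^ toℕ l * z) ^ q
             ≈⟨ *-congˡ {c q} (^-distrib-* (ξ ^ toℕ l) z q) ⟩
           c q * ((ξ ^ toℕ l) ^ q * z ^ q)
             ≈⟨ *-congˡ {c q} (*-congʳ {z ^ q} (begin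
                  (ξ ^ toℕ l) ^ q    ≈⟨ ^-assocʳ ξ (toℕ l) q ⟩
                  ξ ^ (toℕ l ℕ.* q)  ≡⟨ cong (ξ ^_) (ℕ.*-comm (toℕ l) q) ⟩
                  ξ ^ (q ℕ.* toℕ l)  ≈⟨ ^-assocʳ ξ q (toℕ l) ⟨
                  (ξ ^ q) ^ toℕ l    ∎)) ⟩
           c q * ((ξ ^ q) ^ toℕ l * z ^ q)
             ≈⟨ *-Solver.solve 3 (λ c w z → c ⊕ (w ⊕ z) ⊜ (c ⊕ z) ⊕ w) ≈-refl (c q) ((ξ ^ q) ^ toℕ l) (z ^ q) ⟩
           d q * (ξ ^ q) ^ toℕ l ∎) ⟩
    sum {n} (λ l → d q * (ξ ^ q) ^ toℕ l)
      ≈⟨ *-distribˡ-sum {n} (d q) (λ l → (ξ ^ q) ^ toℕ l) ⟨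
    d q * geometricSum n (ξ ^ q) ∎

-- Passage to the limit.

theorem2p12 : (n m : ℕ) .{{_ : NonZero n}} .{{_ : NonZero m}}
    (ξ : ℂ) → IsPrimitiveRoot n ξ →
    (a b : Vector ℂ m) (hb : ∀ i → NoNonPositiveInteger (fromℕ n * b i)) (z : ℂ) →
    let lhs : Fin n → ℕ → ℂ
        lhs l = F-term (λ i → fromℕ n * a i) (λ i → fromℕ n * b i) hb (ξ ^ toℕ l * z)
        rhs : ℕ → ℂ
        rhs = F-term (shifts n a) (shifts n b) (shifts-NoNonPositiveInteger n b hb) (z ^ n)
    in (conv : ∀ l → Convergent (lhs l)) →
       Σ[ conv′ ∈ Convergent rhs ] sum (λ l → ∑∞ (lhs l) (conv l)) ≈ fromℕ n * ∑∞ rhs conv′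
-- The right-hand series is given the left total divided by `n` as its sum, so the equation reduces
-- to cancelling `n`; the substance lies in `rhs-sums`.
theorem2p12 n m ξ ξ-primitive a b hb z conv = (fromℚ r * s , rhs-sums) , ≈-sym (n*r* s)
  where
  lhs : Fin n → ℕ → ℂ
  lhs l = F-term (λ i → fromℕ n * a i) (λ i → fromℕ n * b i) hb (ξ ^ toℕ l * z)
  rhs : ℕ → ℂ
  rhs = F-term (shifts n a) (shifts n b) (shifts-NoNonPositiveInteger n b hb) (z ^ n)
  s = sum λ l → ∑∞ (lhs l) (conv l)
  N = + n ℚ./ 1
  r = recip N
  0<N : 0ℚ ℚ.< N
  0<N = ℚ.positive⁻¹ N {{ℚ.normalize-pos n 1}}
  n*r* : ∀ w → fromℕ n * (fromℚ r * w) ≈ w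
  n*r* w = begin
    fromℕ n * (fromℚ r * w)   ≈⟨ *-assoc (fromℕ n) (fromℚ r) w ⟨
    fromℕ n * fromℚ r * w     ≈⟨ *-congʳ {w} (fromℚ-* N r) ⟨
    fromℚ (N ℚ.* r) * w       ≡⟨ cong (λ t → fromℚ t * w) (recip-inverse 0<N) ⟩
    fromℕ 1 * w               ≈⟨ *-identityˡ w ⟩
    w                         ∎
  partialSums : ∀ p → fromℚ r * sum (λ l → partialSum (lhs l) (p ℕ.* n)) ≈ partialSum rhs p
  partialSums p = begin
    fromℚ r * sum (λ l → partialSum (lhs l) (p ℕ.* n))
      ≈⟨ *-congˡ {fromℚ r} (sum-rotated-powerSeries ξ-primitive c z p) ⟩
    fromℚ r * (fromℕ n * S)
      ≈⟨ *-Solver.solve 3 (λ r n s → r ⊕ (n ⊕ s) ⊜ n ⊕ (r ⊕ s)) ≈-refl (fromℚ r) (fromℕ n) S ⟩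
    fromℕ n * (fromℚ r * S)
      ≈⟨ n*r* S ⟩
    S
      -- `S` still has every n-th coefficient of the original series; these are the coefficients for
      -- the shifted parameters.
      ≈⟨ (sum-cong-≋ {p} λ j → *-congʳ {(z ^ n) ^ toℕ j} (F-coefficient-shifts n a b hb (toℕ j))) ⟨
    partialSum rhs p ∎
    where
    open *-Solver using (_⊕_; _⊜_)
    c = F-coefficient (λ i → fromℕ n * a i) (λ i → fromℕ n * b i) hb
    S = partialSum (λ j → c (j ℕ.* n) * (z ^ n) ^ j) p
  rhs-sums : rhs SumsTo (fromℚ r * s)
  rhs-sums = ⟶-cong partialSums ≈-refl
    (⟶-scale r (recip-pos 0<N)
      -- `p ≤ p * n` holds because `n` is nonzero, so each left series keeps its sum along the
      -- lengths `p * n`.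
      (⟶-sum λ l → ⟶-subsequence (ℕ._* n) (λ p → ℕ.m≤m*n p n) (proj₂ (conv l))))
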